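{- Let $k\ge 2$ and $n$ be positive integers with $k\mid n$, and let $\mathcal{K}^k_n$ be the complete $k$-graph on $n$ vertices. Let $a$ be the largest integer such that $\frac{n}{k}-(a-1)k>0$ and $b$ the largest integer such that $\frac{n}{k}-(b-1)(k+1)>0$. Then for every positive integer $r<\Delta(\mathcal{K}^k_n)$, \[ ms_r(\mathcal{K}^k_n)\ge (r-1)\frac{n}{k}+a\quad\text{and}\quad cms_r(\mathcal{K}^k_n)\ge (r-1)\frac{n}{k}+b. \]
   Context: A $k$-graph is a pair $(V,E)$ where $E$ is a family of $k$-element subsets of $V$; $\mathcal{K}^k_n$ has all $k$-subsets of an $n$-set as edges. The degree of a vertex is the number of edges containing it, and $\Delta$ is the maximum degree. A sub-hypergraph is $(\le r)$-regular if every vertex has degree at most $r$ in it. For an integer $N$, $[N]=\{0,\dots,N-1\}$. An ordering of a hypergraph with edge set $E$ is a bijection $\ell:E\to[|E|]$; edges are consecutive (resp. cyclically consecutive) if their labels are consecutive integers (resp. modulo $|E|$). $ms_r(\mathcal{H})$ (resp. $cms_r(\mathcal{H})$) is the maximum over orderings $\ell$ of the largest $s$ such that every $s$ consecutive (resp. cyclically consecutive) edges of $\ell$ form a $(\le r)$-regular sub-hypergraph. -}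

module Defs where

open import Data.Nat using (ℕ; zero; suc; _+_; _*_; _∸_; _≤_; _<_)
open import Data.Nat.DivMod using (_mod_)
open import Data.Nat.Combinatorics using (_C_)
open import Data.Fin using (Fin; toℕ)
open import Data.Fin.Subset using (Subset; _∈_; ∣_∣)
open import Data.Fin.Subset.Properties using (_∈?_)
open import Data.Bool using (Bool; true; false; if_then_else_)
open import Data.Product using (Σ; ∃; _×_; _,_)
open import Relation.Nullary using (does)
open import Relation.Binary.PropositionalEquality using (_≡_)
open import Function.Definitions using (Injective)

-- Edges of the complete k-graph K^k_n on vertex set Fin n: the k-subsets of Fin n.
-- There are N = n C k of them.

-- An ordering ℓ : E → [|E|] is a bijection; we represent it by its inverse
-- σ : Fin (n C k) → Subset n, where σ i is the edge with label i.
record Ordering (n k : ℕ) : Set where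
  field
    σ         : Fin (n C k) → Subset n
    isEdge    : ∀ i → ∣ σ i ∣ ≡ k
    injective : Injective _≡_ _≡_ σ
    surjective : ∀ (e : Subset n) → ∣ e ∣ ≡ k → Σ (Fin (n C k)) (λ i → σ i ≡ e)
open Ordering public

shift : ∀ {N} → Fin N → ℕ → Fin N
shift {suc N} i j = (toℕ i + j) mod (suc N)

countBelow : ℕ → (ℕ → Bool) → ℕ
countBelow zero    P = 0
countBelow (suc s) P = countBelow s P + (if P s then 1 else 0)

windowDegree : ∀ {n N} → (Fin N → Subset n) → Fin N → ℕ → Fin n → ℕ
windowDegree σ i s v = countBelow s (λ j → does (v ∈? σ (shift i j)))

WindowRegular : ∀ {n N} → (Fin N → Subset n) → ℕ → Fin N → ℕ → Set
WindowRegular {n} σ r i s = ∀ (v : Fin n) → windowDegree σ i s v ≤ r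

-- every s consecutive edges of the ordering form a (≤ r)-regular sub-hypergraph
-- (windows i, …, i+s-1 with i+s ≤ N; s ≤ N so that such windows exist)
ConsecRegular : ∀ {n k} → Ordering n k → ℕ → ℕ → Set
ConsecRegular {n} {k} ℓ r s =
  s ≤ n C k × (∀ (i : Fin (n C k)) → toℕ i + s ≤ n C k → WindowRegular (σ ℓ) r i s)

CycConsecRegular : ∀ {n k} → Ordering n k → ℕ → ℕ → Set
CycConsecRegular {n} {k} ℓ r s =
  s ≤ n C k × (∀ (i : Fin (n C k)) → WindowRegular (σ ℓ) r i s)

-- ms_r(K^k_n) ≥ m : some ordering admits some s ≥ m with every s consecutive
-- edges (≤ r)-regular (i.e. the max over orderings of the largest such s is ≥ m)
msAtLeast : ℕ → ℕ → ℕ → ℕ → Set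
msAtLeast n k r m = Σ (Ordering n k) λ ℓ → Σ ℕ λ s → m ≤ s × ConsecRegular ℓ r s

cmsAtLeast : ℕ → ℕ → ℕ → ℕ → Set
cmsAtLeast n k r m = Σ (Ordering n k) λ ℓ → Σ ℕ λ s → m ≤ s × CycConsecRegular ℓ r s

-- maximum degree of K^k_n (every vertex lies in C(n-1,k-1) edges)
ΔK : ℕ → ℕ → ℕ
ΔK n k = (n ∸ 1) C (k ∸ 1)

{-# OPTIONS --safe #-}

-- The edges of K^k_n are split into Δ perfect matchings of q = n/k edges
-- (Baranyai), which are listed one after another.  Baranyai's theorem is proved
-- by adding vertices one at a time: when m + 1 vertices are missing, each
-- partial matching must choose the block that receives the next vertex so that
-- every set S is chosen C(m, k − |S| − 1) times; giving the block S the weight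
-- k − |S| makes this a transport problem whose fractional solution is uniform,
-- and an integral one is found by augmenting paths.
--
-- A window of (r − 1) q + L edges with L ≤ q meets at most r + 1 consecutive
-- matchings, so a vertex of degree r + 1 would lie in its first and its last
-- edges, which belong to matchings r apart.  It remains to order each matching
-- so that its first edges avoid the last edges of the matching r places before
-- and, in the cyclic case, its last edges avoid the first edges of the matching
-- r places after.  Since an edge meets at most k edges of a matching, the
-- inequalities defining a and b are what a greedy choice needs.
module Submission where

open import Defs
import Algebra.Properties.CommutativeSemigroup
import Algebra.Properties.Semiring.Sum
open import Data.Bool using (Bool; if_then_else_; true; false)
import Data.Bool.Properties as Bool
open import Data.Empty using (⊥)
open import Data.Fin as Fin using (Fin; zero; suc; toℕ; fromℕ<; combine; punchOut)
import Data.Fin.Properties as Fin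
open import Data.Fin.Subset using (Subset; _∈_; ∣_∣)
open import Data.Fin.Subset.Properties using (_∈?_)
open import Data.Nat hiding (_≟_; Ordering)
open import Data.Nat.Combinatorics using (_C_; nCk+nC[k+1]≡[n+1]C[k+1]; k>n⇒nCk≡0; nCk≡nC[n∸k]; nCn≡1)
open import Data.Nat.Divisibility using (n∣m*n)
open import Data.Nat.DivMod
open import Data.Nat.Properties hiding (_≟_)
import Data.Nat.Properties as ℕ
open import Data.Nat.Solver using (module +-*-Solver)
open import Data.Product
open import Data.Sum using (_⊎_; inj₁; inj₂)
open import Data.Vec using ([]; _∷_; here; there)
open import Data.Vec.Functional using (updateAt)
open import Data.Vec.Functional.Properties using (updateAt-updates; updateAt-minimal)
import Data.Vec.Properties as Vec
open import Function using (_∘_; const; id)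
open import Function.Definitions using (Injective)
open import Relation.Binary.Definitions using (DecidableEquality)
open import Relation.Binary.PropositionalEquality
open import Relation.Nullary

module +-Props = Algebra.Properties.CommutativeSemigroup +-commutativeSemigroup
module *-Props = Algebra.Properties.CommutativeSemigroup *-commutativeSemigroup
module Sum = Algebra.Properties.Semiring.Sum +-*-semiring

-- Indicators and finite sums of natural numbers.

⟦_⟧ : ∀ {a} {A : Set a} → Dec A → ℕ
⟦ A? ⟧ = if does A? then 1 else 0

⟦⟧≡1 : ∀ {a} {A : Set a} (A? : Dec A) → A → ⟦ A? ⟧ ≡ 1
⟦⟧≡1 (yes _) _ = refl
⟦⟧≡1 (no ¬a) a = contradiction a ¬a

⟦⟧≡0 : ∀ {a} {A : Set a} (A? : Dec A) → ¬ A → ⟦ A? ⟧ ≡ 0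
⟦⟧≡0 (yes a) ¬a = contradiction a ¬a
⟦⟧≡0 (no _)  _  = refl

⟦⟧≤1 : ∀ {a} {A : Set a} (A? : Dec A) → ⟦ A? ⟧ ≤ 1
⟦⟧≤1 (yes _) = ≤-refl
⟦⟧≤1 (no _)  = z≤n

⟦⟧>0 : ∀ {a} {A : Set a} (A? : Dec A) → 0 < ⟦ A? ⟧ → A
⟦⟧>0 (yes a) _ = a

δ : ∀ {n} → Fin n → Fin n → ℕ
δ i j = ⟦ i Fin.≟ j ⟧

-- The summation operator is opaque so that its arguments can be inferred.
opaque
  sum : ∀ {n} → (Fin n → ℕ) → ℕ
  sum = Sum.sum

  sum-suc : ∀ {n} (f : Fin (suc n) → ℕ) → sum f ≡ f zero + sum (f ∘ suc)
  sum-suc f = refl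

  sum-zero : (f : Fin 0 → ℕ) → sum f ≡ 0
  sum-zero f = refl

  sum-cong : ∀ {n} {f g : Fin n → ℕ} → (∀ i → f i ≡ g i) → sum f ≡ sum g
  sum-cong = Sum.sum-cong-≗

  sum-distrib-+ : ∀ {n} (f g : Fin n → ℕ) → sum (λ i → f i + g i) ≡ sum f + sum g
  sum-distrib-+ = Sum.∑-distrib-+

  sum-comm : ∀ {m n} (f : Fin m → Fin n → ℕ) →
             sum (λ i → sum (λ j → f i j)) ≡ sum (λ j → sum (λ i → f i j))
  sum-comm = Sum.∑-comm

  *-distribˡ-sum : ∀ {n} x (f : Fin n → ℕ) → x * sum f ≡ sum (λ i → x * f i)
  *-distribˡ-sum = Sum.*-distribˡ-sum

  *-distribʳ-sum : ∀ {n} x (f : Fin n → ℕ) → sum f * x ≡ sum (λ i → f i * x)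
  *-distribʳ-sum = Sum.*-distribʳ-sum

  sum-mono-≤ : ∀ {n} {f g : Fin n → ℕ} → (∀ i → f i ≤ g i) → sum f ≤ sum g
  sum-mono-≤ {zero}  f≤g = z≤n
  sum-mono-≤ {suc n} f≤g = +-mono-≤ (f≤g zero) (sum-mono-≤ (f≤g ∘ suc))

  sum-const : ∀ n x → sum {n} (λ _ → x) ≡ n * x
  sum-const zero    x = refl
  sum-const (suc n) x = cong (x +_) (sum-const n x)

  sum≤n : ∀ {n} {f : Fin n → ℕ} → (∀ i → f i ≤ 1) → sum f ≤ n
  sum≤n {n} f≤1 = ≤-trans (sum-mono-≤ f≤1) (≤-reflexive (trans (sum-const n 1) (*-identityʳ n)))

  term≤sum : ∀ {n} (f : Fin n → ℕ) i → f i ≤ sum f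
  term≤sum f zero    = m≤m+n _ _
  term≤sum f (suc i) = ≤-trans (term≤sum (f ∘ suc) i) (m≤n+m _ _)

  sum-δ : ∀ {n} (f : Fin n → ℕ) i → sum (λ j → δ i j * f j) ≡ f i
  sum-δ {suc n} f zero    = trans (cong₂ _+_ (*-identityˡ (f zero)) (Sum.sum-replicate-zero n)) (+-identityʳ _)
  sum-δ         f (suc i) = sum-δ (f ∘ suc) i

  -- Changing one summand, stated additively so that no truncated subtraction occurs.
  sum-exchange : ∀ {n} {f g : Fin n → ℕ} i → (∀ j → j ≢ i → f j ≡ g j) →
                 sum f + g i ≡ sum g + f i
  sum-exchange {f = f} {g} zero f≡g
    rewrite sum-cong {f = f ∘ suc} {g ∘ suc} (λ j → f≡g (suc j) λ ()) =
    +-Props.xy∙z≈zy∙x (f zero) (sum (g ∘ suc)) (g zero)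
  sum-exchange {f = f} {g} (suc i) f≡g
    rewrite f≡g zero (λ ()) = begin
      g zero + sum (f ∘ suc) + g (suc i)    ≡⟨ +-assoc (g zero) _ _ ⟩
      g zero + (sum (f ∘ suc) + g (suc i))
        ≡⟨ cong (g zero +_) (sum-exchange i λ j j≢i → f≡g (suc j) (j≢i ∘ Fin.suc-injective)) ⟩
      g zero + (sum (g ∘ suc) + f (suc i))  ≡⟨ +-assoc (g zero) _ _ ⟨
      g zero + sum (g ∘ suc) + f (suc i)    ∎
    where open ≡-Reasoning

  sum-≤-≡ : ∀ {n} {f g : Fin n → ℕ} → (∀ i → f i ≤ g i) → sum f ≡ sum g → ∀ i → f i ≡ g i
  sum-≤-≡ {f = f} {g} f≤g eq zero = ≤-antisym (f≤g zero)
    (+-cancelʳ-≤ (sum (f ∘ suc)) _ _ (≤-trans (+-monoʳ-≤ (g zero) (sum-mono-≤ (f≤g ∘ suc))) (≤-reflexive (sym eq))))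
  sum-≤-≡ {f = f} {g} f≤g eq (suc i) = sum-≤-≡ (f≤g ∘ suc)
    (+-cancelˡ-≡ (f zero) _ _ (trans eq (cong (_+ sum (g ∘ suc)) (sym (sum-≤-≡ f≤g eq zero))))) i

sum-δ-1 : ∀ {n} (i : Fin n) → sum (δ i) ≡ 1
sum-δ-1 i = trans (sum-cong λ j → sym (*-identityʳ (δ i j))) (sum-δ (const 1) i)

-- Groups the terms by the value of `f`. This is the double counting that converts totals over rows
-- into totals over columns.
sum-fibres : ∀ {n p} (f : Fin n → Fin p) (x : Fin n → ℕ) (g : Fin p → ℕ) →
             sum (λ i → g (f i) * x i) ≡ sum (λ j → g j * sum (λ i → δ (f i) j * x i))
sum-fibres f x g = begin
  sum (λ i → g (f i) * x i)                        ≡⟨ sum-cong (λ i → sum-δ (λ j → g j * x i) (f i)) ⟨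
  sum (λ i → sum (λ j → δ (f i) j * (g j * x i)))  ≡⟨ sum-comm _ ⟩
  sum (λ j → sum (λ i → δ (f i) j * (g j * x i)))
    ≡⟨ sum-cong (λ j → trans (sum-cong (λ i → *-Props.x∙yz≈y∙xz (δ (f i) j) (g j) (x i))) (sym (*-distribˡ-sum (g j) _))) ⟩
  sum (λ j → g j * sum (λ i → δ (f i) j * x i))    ∎
  where
  open ≡-Reasoning

-- Integral solutions of transport problems.

load : ∀ {m p q} → (Fin m → Fin q → Fin p) → (Fin m → Fin q) → Fin p → ℕ
load κ c j = sum λ i → δ (κ i (c i)) j

inflow : ∀ {m p q} → (Fin m → Fin q → Fin p) → (Fin m → Fin q → ℕ) → Fin p → ℕ
inflow κ w j = sum λ i → sum λ t → δ (κ i t) j * w i t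

-- Row `i` may take any option `t` of positive weight and then loads column `κ i t`. Options and
-- columns are kept apart because several options of a row may share a column, as several empty
-- blocks of one partition do.
Assignment : ∀ {m p q} → (Fin m → Fin q → Fin p) → (Fin m → Fin q → ℕ) → (Fin p → ℕ) → Set
Assignment {m} {p} {q} κ w d =
  Σ[ c ∈ (Fin m → Fin q) ] (∀ i → 0 < w i (c i)) × (∀ j → load κ c j ≤ d j)

-- Row `zero` is the row still to be served; `c` already serves the rows `suc i`.
module Augment {m p q} (D : ℕ) (d : Fin p → ℕ) (κ : Fin (suc m) → Fin q → Fin p)
  (w : Fin (suc m) → Fin q → ℕ) (D>0 : 0 < D) (rows : ∀ i → sum (w i) ≡ D)
  (cols : ∀ j → inflow κ w j ≤ D * d j)
  (c : Fin m → Fin q) (c>0 : ∀ i → 0 < w (suc i) (c i)) where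

  col : Fin m → Fin p
  col i = κ (suc i) (c i)

  ℓ : Fin p → ℕ
  ℓ = load (κ ∘ suc) c

  -- Column j can absorb one more row by moving only rows whose present column
  -- lies in J and differs from j.
  record Reach (J : Fin p → ℕ) (j : Fin p) : Set where
    field
      c′    : Fin (suc m) → Fin q
      c′>0  : ∀ i → 0 < w i (c′ i)
      loads : ∀ j′ → load κ c′ j′ ≡ ℓ j′ + δ j j′
      keeps : ∀ i → J (col i) ≡ 0 ⊎ col i ≡ j → c′ (suc i) ≡ c i
  open Reach

  -- `J` is the indicator of the visited columns. The active rows are those an alternating path may
  -- move: the new row, and every row now sitting in a visited column.
  active : (Fin p → ℕ) → Fin (suc m) → ℕ
  active J zero    = 1
  active J (suc i) = J (col i)

  add : (Fin p → ℕ) → Fin p → Fin p → ℕ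
  add J j j′ = J j′ + δ j j′

  reach-mono : ∀ J j {j₀} → Reach J j₀ → Reach (add J j) j₀
  reach-mono J j R = record
    { c′ = c′ R ; c′>0 = c′>0 R ; loads = loads R
    ; keeps = λ { i (inj₁ J≡0) → keeps R i (inj₁ (m+n≡0⇒m≡0 _ J≡0))
                ; i (inj₂ eq) → keeps R i (inj₂ eq) } }

  -- The new row can simply be placed at its option. Any other active row sits in a column that can
  -- absorb one more row without moving it, by `keeps`; moving this row to option `t` afterwards
  -- passes the surplus on to `κ i t`.
  reach-new : ∀ J i t → (∀ j → 0 < J j → Reach J j) → 0 < active J i → 0 < w i t →
              J (κ i t) ≡ 0 → Reach (add J (κ i t)) (κ i t)
  reach-new J zero t _ _ wit Jκ = record
    { c′    = λ { zero → t ; (suc i) → c i }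
    ; c′>0  = λ { zero → wit ; (suc i) → c>0 i }
    ; loads = λ j′ → trans (sum-suc _) (+-comm (δ (κ zero t) j′) (ℓ j′))
    ; keeps = λ _ _ → refl }
  reach-new J (suc i) t reach Ji wit Jκ = record
    { c′    = c″
    ; c′>0  = pos
    ; loads = λ j′ → +-cancelʳ-≡ (δ (col i) j′) _ _ (begin
        load κ c″ j′ + δ (col i) j′
          ≡⟨ cong (λ s → load κ c″ j′ + δ (κ (suc i) s) j′) (keeps R i (inj₂ refl)) ⟨
        load κ c″ j′ + δ (κ (suc i) (c′ R (suc i))) j′
          ≡⟨ sum-exchange (suc i) (λ i′ i′≢i → cong (λ s → δ (κ i′ s) j′) (updateAt-minimal i′ (suc i) {const t} (c′ R) i′≢i)) ⟩
        load κ (c′ R) j′ + δ (κ (suc i) (c″ (suc i))) j′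
          ≡⟨ cong₂ (λ x s → x + δ (κ (suc i) s) j′) (loads R j′) (updateAt-updates (suc i) (c′ R)) ⟩
        ℓ j′ + δ (col i) j′ + δ (κ (suc i) t) j′
          ≡⟨ +-Props.xy∙z≈xz∙y (ℓ j′) (δ (col i) j′) _ ⟩
        ℓ j′ + δ (κ (suc i) t) j′ + δ (col i) j′ ∎)
    ; keeps = keep }
    where
    open ≡-Reasoning
    R = reach (col i) Ji
    c″ : Fin (suc m) → Fin q
    c″ = updateAt (c′ R) (suc i) (const t)
    pos : ∀ i′ → 0 < w i′ (c″ i′)
    pos i′ with i′ Fin.≟ suc i
    ... | yes refl = subst (λ s → 0 < w (suc i) s) (sym (updateAt-updates (suc i) (c′ R))) wit
    ... | no i′≢i = subst (λ s → 0 < w i′ s) (sym (updateAt-minimal i′ (suc i) (c′ R) i′≢i)) (c′>0 R i′)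
    -- Both alternatives put the column outside the old `J`, the second because the new column was
    -- not yet visited. So row `i′` is not the row that was moved.
    old : ∀ i′ → add J (κ (suc i) t) (col i′) ≡ 0 ⊎ col i′ ≡ κ (suc i) t → J (col i′) ≡ 0
    old i′ (inj₁ eq) = m+n≡0⇒m≡0 _ eq
    old i′ (inj₂ eq) = trans (cong J eq) Jκ
    keep : ∀ i′ → add J (κ (suc i) t) (col i′) ≡ 0 ⊎ col i′ ≡ κ (suc i) t → c″ (suc i′) ≡ c i′
    keep i′ new = trans
      (updateAt-minimal (suc i′) (suc i) (c′ R) λ { refl → <⇒≢ Ji (sym (old i′ new)) })
      (keeps R i′ (inj₁ (old i′ new)))

  -- A saturated set of columns closed under alternating paths receives more
  -- from the active rows than it can hold.
  closed⇒⊥ : ∀ J → (∀ j → J j ≤ 1) → (∀ j → 0 < J j → d j ≤ ℓ j) →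
             (∀ i t → 0 < active J i → 0 < w i t → J (κ i t) ≢ 0) → ⊥
  -- The extra `suc` is the new row, which is active but loads no column yet.
  closed⇒⊥ J J≤1 full closed = <⇒≱ (*-monoʳ-< D {{>-nonZero D>0}} (n<1+n (sum (J ∘ col)))) (begin
    D * suc (sum (J ∘ col))                                ≡⟨ cong (D *_) (sum-suc (active J)) ⟨
    D * sum (active J)                                     ≡⟨ *-comm D _ ⟩
    sum (active J) * D                                     ≡⟨ *-distribʳ-sum D (active J) ⟩
    sum (λ i → active J i * D)
      ≡⟨ sum-cong (λ i → trans (cong (active J i *_) (sym (rows i))) (*-distribˡ-sum (active J i) (w i))) ⟩
    sum (λ i → sum (λ t → active J i * w i t))             ≤⟨ sum-mono-≤ (λ i → sum-mono-≤ (edge i)) ⟩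
    sum (λ i → sum (λ t → J (κ i t) * w i t))              ≡⟨ sum-cong (λ i → sum-fibres (κ i) (w i) J) ⟩
    sum (λ i → sum (λ j → J j * sum (λ t → δ (κ i t) j * w i t)))
      ≡⟨ sum-comm _ ⟩
    sum (λ j → sum (λ i → J j * sum (λ t → δ (κ i t) j * w i t)))
      ≡⟨ sum-cong (λ j → *-distribˡ-sum (J j) _) ⟨
    sum (λ j → J j * inflow κ w j)                         ≤⟨ sum-mono-≤ sat ⟩
    sum (λ j → D * (J j * ℓ j))                            ≡⟨ *-distribˡ-sum D _ ⟨
    D * sum (λ j → J j * ℓ j)
      ≡⟨ cong (D *_) (sum-cong (λ j → cong (J j *_) (sum-cong λ i → sym (*-identityʳ (δ (col i) j))))) ⟩
    D * sum (λ j → J j * sum (λ i → δ (col i) j * 1))      ≡⟨ cong (D *_) (sum-fibres col (const 1) J) ⟨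
    D * sum (λ i → J (col i) * 1)
      ≡⟨ cong (D *_) (sum-cong (λ i → *-identityʳ _)) ⟩
    D * sum (J ∘ col)                                      ∎)
    where
    open ≤-Reasoning
    active≤1 : ∀ i → active J i ≤ 1
    active≤1 zero    = ≤-refl
    active≤1 (suc i) = J≤1 (col i)
    edge : ∀ i t → active J i * w i t ≤ J (κ i t) * w i t
    edge i t with 0 <? active J i | 0 <? w i t
    ... | no ¬a | _ rewrite n≤0⇒n≡0 (≮⇒≥ ¬a) = z≤n
    ... | yes _ | no ¬w rewrite n≤0⇒n≡0 (≮⇒≥ ¬w) | *-zeroʳ (active J i) = z≤n
    ... | yes a | yes w>0 = *-monoˡ-≤ (w i t) (≤-trans (active≤1 i) (n≢0⇒n>0 (closed i t a w>0)))
    sat : ∀ j → J j * inflow κ w j ≤ D * (J j * ℓ j)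
    sat j with 0 <? J j
    ... | no ¬J rewrite n≤0⇒n≡0 (≮⇒≥ ¬J) = z≤n
    ... | yes J>0 = ≤-trans (*-monoʳ-≤ (J j) (≤-trans (cols j) (*-monoʳ-≤ D (full j J>0))))
      (≤-reflexive (*-Props.x∙yz≈y∙xz (J j) D (ℓ j)))

  -- A newly reached column either has room, which ends the search, or is saturated and joins `J`.
  -- In the second case `sum J + fuel` is unchanged, and since `J` holds at most `p` columns the
  -- fuel cannot run out.
  search : (∀ j → ℓ j ≤ d j) → ∀ fuel J → (∀ j → J j ≤ 1) → (∀ j → 0 < J j → Reach J j) →
           (∀ j → 0 < J j → d j ≤ ℓ j) → p < sum J + fuel → Assignment κ w d
  search ℓ≤d zero J J≤1 _ _ p<∣J∣ =
    contradiction (≤-trans p<∣J∣ (≤-trans (≤-reflexive (+-identityʳ _)) (sum≤n J≤1))) 1+n≰n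
  search ℓ≤d (suc fuel) J J≤1 reach full p<∣J∣
    with Fin.any? (λ i → Fin.any? λ t → (0 <? active J i) ×-dec (0 <? w i t) ×-dec (J (κ i t) ℕ.≟ 0))
  ... | no ¬new = contradiction (λ i t a w>0 J≡0 → ¬new (i , t , a , w>0 , J≡0)) (closed⇒⊥ J J≤1 full)
  ... | yes (i , t , a , w>0 , J≡0) with reach-new J i t reach a w>0 J≡0 | ℓ (κ i t) <? d (κ i t)
  ...   | R | yes ℓ<d = c′ R , c′>0 R , λ j → ≤-trans (≤-reflexive (loads R j)) (room j)
    where
    room : ∀ j → ℓ j + δ (κ i t) j ≤ d j
    room j with κ i t Fin.≟ j
    ... | yes refl = ≤-trans (≤-reflexive (+-comm _ 1)) ℓ<d
    ... | no _     = ≤-trans (≤-reflexive (+-identityʳ _)) (ℓ≤d j)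
  ...   | R | no ℓ≮d = search ℓ≤d fuel (add J (κ i t)) J′≤1 reach′ full′
          (≤-trans p<∣J∣ (≤-reflexive (begin
            sum J + suc fuel                ≡⟨ +-assoc (sum J) 1 fuel ⟨
            sum J + 1 + fuel                ≡⟨ cong (λ x → sum J + x + fuel) (sum-δ-1 (κ i t)) ⟨
            sum J + sum (δ (κ i t)) + fuel  ≡⟨ cong (_+ fuel) (sum-distrib-+ J (δ (κ i t))) ⟨
            sum (add J (κ i t)) + fuel      ∎)))
    where
    open ≡-Reasoning
    J′≤1 : ∀ j → add J (κ i t) j ≤ 1
    J′≤1 j with κ i t Fin.≟ j
    ... | yes refl rewrite J≡0 = ≤-refl
    ... | no _     = ≤-trans (≤-reflexive (+-identityʳ _)) (J≤1 j)
    reach′ : ∀ j → 0 < add J (κ i t) j → Reach (add J (κ i t)) j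
    reach′ j J′>0 with κ i t Fin.≟ j
    ... | yes refl = R
    ... | no _     = reach-mono J (κ i t) (reach j (≤-trans J′>0 (≤-reflexive (+-identityʳ _))))
    full′ : ∀ j → 0 < add J (κ i t) j → d j ≤ ℓ j
    full′ j J′>0 with κ i t Fin.≟ j
    ... | yes refl = ≮⇒≥ ℓ≮d
    ... | no _     = full j (≤-trans J′>0 (≤-reflexive (+-identityʳ _)))

-- The weights divided by `D` solve the problem fractionally. Rows are inserted one by one, each by
-- an augmenting search that starts from the empty `J`.
assignment : ∀ {m p q} (D : ℕ) (d : Fin p → ℕ) (κ : Fin m → Fin q → Fin p) (w : Fin m → Fin q → ℕ) →
             0 < D → (∀ i → sum (w i) ≡ D) → (∀ j → inflow κ w j ≤ D * d j) → Assignment κ w d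
assignment {zero} D d κ w D>0 rows cols = (λ ()) , (λ ()) , λ _ → ≤-trans (≤-reflexive (sum-zero _)) z≤n
assignment {suc m} {p} D d κ w D>0 rows cols
  with assignment D d (κ ∘ suc) (w ∘ suc) D>0 (rows ∘ suc) (λ j → ≤-trans (m≤n+m _ _) (≤-trans (≤-reflexive (sym (sum-suc _))) (cols j)))
... | c , c>0 , ℓ≤d = search ℓ≤d (suc p) (const 0) (λ _ → z≤n) (λ _ ()) (λ _ ()) (m≤n+m _ _)
  where open Augment D d κ w D>0 rows cols c c>0

-- When every column is filled exactly by the fractional solution, the capacities sum to the number
-- of rows, which is also the total load; the inequalities between loads and capacities are then
-- equalities.
exactAssignment : ∀ {m p q} (D : ℕ) (d : Fin p → ℕ) (κ : Fin m → Fin q → Fin p) (w : Fin m → Fin q → ℕ) →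
  0 < D → (∀ i → sum (w i) ≡ D) → (∀ j → inflow κ w j ≡ D * d j) →
  Σ[ c ∈ (Fin m → Fin q) ] (∀ i → 0 < w i (c i)) × (∀ j → load κ c j ≡ d j)
exactAssignment {m} D d κ w D>0 rows cols
  with assignment D d κ w D>0 rows (≤-reflexive ∘ cols)
... | c , c>0 , ℓ≤d = c , c>0 , sum-≤-≡ ℓ≤d (trans total (sym (*-cancelˡ-≡ _ _ D {{>-nonZero D>0}} capacity)))
  where
  open ≡-Reasoning
  total : sum (load κ c) ≡ m
  total = begin
    sum (load κ c)                              ≡⟨ sum-comm _ ⟩
    sum (λ i → sum (λ j → δ (κ i (c i)) j))     ≡⟨ sum-cong (λ i → sum-δ-1 (κ i (c i))) ⟩
    sum {m} (λ _ → 1)                           ≡⟨ trans (sum-const m 1) (*-identityʳ m) ⟩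
    m                                           ∎
  capacity : D * sum d ≡ D * m
  capacity = begin
    D * sum d                                                  ≡⟨ *-distribˡ-sum D d ⟩
    sum (λ j → D * d j)                                        ≡⟨ sum-cong cols ⟨
    sum (inflow κ w)                                           ≡⟨ sum-comm _ ⟩
    sum (λ i → sum (λ j → sum (λ t → δ (κ i t) j * w i t)))
      ≡⟨ sum-cong (λ i → sum-cong λ j → *-identityˡ _) ⟨
    sum (λ i → sum (λ j → 1 * sum (λ t → δ (κ i t) j * w i t)))
      ≡⟨ sum-cong (λ i → sum-fibres (κ i) (w i) (const 1)) ⟨
    sum (λ i → sum (λ t → 1 * w i t))
      ≡⟨ sum-cong (λ i → trans (sum-cong λ t → *-identityˡ _) (rows i)) ⟩
    sum {m} (λ _ → D)                                          ≡⟨ trans (sum-const m D) (*-comm m D) ⟩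
    D * m                                                      ∎

-- Counting the completions of a set.

∸-suc : ∀ {m n} → m < n → n ∸ m ≡ suc (n ∸ suc m)
∸-suc = +-∸-assoc 1

0<n∸m⇒m<n : ∀ n m → 0 < n ∸ m → m < n
0<n∸m⇒m<n n m 0<n∸m = ≰⇒> λ n≤m → <⇒≢ 0<n∸m (sym (m≤n⇒m∸n≡0 n≤m))

-- The number of ways to enlarge a set of s elements to one of k elements using
-- m further elements.
ext : ℕ → ℕ → ℕ → ℕ
ext k zero    s = ⟦ s ℕ.≟ k ⟧
ext k (suc m) s = ext k m s + ext k m (suc s)

ext≡0 : ∀ {k s} m → k < s → ext k m s ≡ 0
ext≡0 {k} {s} zero k<s = ⟦⟧≡0 (s ℕ.≟ k) (>⇒≢ k<s)
ext≡0 (suc m) k<s rewrite ext≡0 m k<s = ext≡0 m (m<n⇒m<1+n k<s)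

nC0≡1 : ∀ n → n C 0 ≡ 1
nC0≡1 n = trans (nCk≡nC[n∸k] {0} {n} z≤n) (nCn≡1 n)

-- The recursion of `ext` is Pascal's rule. The bound `s ≤ k` matters: beyond it `ext` vanishes,
-- whereas `k ∸ s` truncates and the binomial coefficient would be 1.
ext≡C : ∀ {k s} m → s ≤ k → ext k m s ≡ m C (k ∸ s)
ext≡C {k} {s} m s≤k with m≤n⇒m<n∨m≡n s≤k
ext≡C {k} zero s≤k | inj₂ refl rewrite n∸n≡0 k = ⟦⟧≡1 (k ℕ.≟ k) refl
ext≡C {k} {s} zero s≤k | inj₁ s<k =
  trans (⟦⟧≡0 (s ℕ.≟ k) (<⇒≢ s<k)) (sym (k>n⇒nCk≡0 (m<n⇒0<n∸m s<k)))
ext≡C {k} (suc m) s≤k | inj₂ refl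
  rewrite ext≡C m (≤-refl {k}) | ext≡0 m (n<1+n k) | n∸n≡0 k | nC0≡1 m = sym (nC0≡1 (suc m))
ext≡C {k} {s} (suc m) s≤k | inj₁ s<k
  rewrite ext≡C m s≤k | ext≡C m s<k | ∸-suc s<k =
  trans (+-comm (m C suc (k ∸ suc s)) _) (nCk+nC[k+1]≡[n+1]C[k+1] m (k ∸ suc s))

-- Both sides count the completions with one added element marked. This absorption identity is
-- exactly the column condition of the transport problem for the next vertex.
ext-absorb : ∀ k m s → ext k (suc m) s * (k ∸ s) ≡ suc m * ext k m (suc s)
ext-absorb k m s with k ≤? s
... | yes k≤s rewrite m≤n⇒m∸n≡0 k≤s | ext≡0 m (s≤s k≤s) =
  trans (*-zeroʳ (ext k m s + 0)) (sym (*-zeroʳ m))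
ext-absorb k zero s | no k≰s rewrite ⟦⟧≡0 (s ℕ.≟ k) (λ { refl → k≰s ≤-refl }) with suc s ℕ.≟ k
... | yes refl rewrite m+n∸n≡m 1 s = trans (*-identityʳ _) (sym (+-identityʳ _))
... | no ≢k rewrite ⟦⟧≡0 (suc s ℕ.≟ k) ≢k = refl
ext-absorb k (suc m) s | no k≰s = begin
  (ext k (suc m) s + e) * (k ∸ s)               ≡⟨ *-distribʳ-+ (k ∸ s) (ext k (suc m) s) e ⟩
  ext k (suc m) s * (k ∸ s) + e * (k ∸ s)
    ≡⟨ cong₂ _+_ (ext-absorb k m s) (cong (e *_) (∸-suc (≰⇒> k≰s))) ⟩
  suc m * ext k m (suc s) + e * suc (k ∸ suc s)
    ≡⟨ cong (suc m * ext k m (suc s) +_) (trans (*-suc e _) (cong (e +_) (ext-absorb k m (suc s)))) ⟩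
  suc m * ext k m (suc s) + (e + suc m * ext k m (2+ s))
                                                ≡⟨ +-Props.x∙yz≈y∙xz (suc m * ext k m (suc s)) e (suc m * ext k m (2+ s)) ⟩
  e + (suc m * ext k m (suc s) + suc m * ext k m (2+ s))
                                                ≡⟨ cong (e +_) (*-distribˡ-+ (suc m) (ext k m (suc s)) _) ⟨
  e + suc m * e                                 ∎
  where
  open ≡-Reasoning
  e = ext k (suc m) (suc s)

-- Binary codes of subsets.

bit : Bool → Fin 2
bit false = zero
bit true  = suc zero

bit-injective : ∀ {a b} → bit a ≡ bit b → a ≡ b
bit-injective {false} {false} _ = refl
bit-injective {true}  {true}  _ = refl

bit-surjective : ∀ i → ∃ λ b → bit b ≡ i
bit-surjective zero       = false , refl
bit-surjective (suc zero) = true , refl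

-- Subsets are numbered so that they can serve as the columns `Fin p` of a transport problem.
code : ∀ {l} → Subset l → Fin (2 ^ l)
code []      = zero
code (b ∷ S) = combine (bit b) (code S)

code-injective : ∀ {l} {S T : Subset l} → code S ≡ code T → S ≡ T
code-injective {S = []}    {[]}    _  = refl
code-injective {S = a ∷ S} {b ∷ T} eq with Fin.combine-injective (bit a) (code S) (bit b) (code T) eq
... | eq₁ , eq₂ = cong₂ _∷_ (bit-injective eq₁) (code-injective eq₂)

code-surjective : ∀ {l} (j : Fin (2 ^ l)) → ∃ λ S → code {l} S ≡ j
code-surjective {zero} zero = [] , refl
code-surjective {suc l} j with Fin.combine-surjective {2} {2 ^ l} j
... | a , j′ , eq with bit-surjective a | code-surjective {l} j′
...   | b , refl | S , refl = b ∷ S , eq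

infix 4 _≟ˢ_
_≟ˢ_ : ∀ {l} → DecidableEquality (Subset l)
_≟ˢ_ = Vec.≡-dec Bool._≟_

⟦⟧-⇔ : ∀ {a b} {A : Set a} {B : Set b} (A? : Dec A) (B? : Dec B) → (A → B) → (B → A) → ⟦ A? ⟧ ≡ ⟦ B? ⟧
⟦⟧-⇔ (yes a) B? f g = sym (⟦⟧≡1 B? (f a))
⟦⟧-⇔ (no ¬a) B? f g = sym (⟦⟧≡0 B? (¬a ∘ g))

δ-code : ∀ {l} (S T : Subset l) → δ (code S) (code T) ≡ ⟦ S ≟ˢ T ⟧
δ-code S T = ⟦⟧-⇔ (code S Fin.≟ code T) (S ≟ˢ T) code-injective (cong code)

-- Baranyai's theorem.

Family : ℕ → ℕ → ℕ → Set
Family M q l = Fin M → Fin q → Subset l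

occurrences : ∀ {M q l} → Family M q l → Subset l → ℕ
occurrences B S = sum λ i → sum λ t → ⟦ B i t ≟ˢ S ⟧

-- M partitions of an l-set into q blocks (possibly empty), with m vertices still to
-- be added, in which S occurs as often as it has completions to a k-set.
record Partial (k M q l m : ℕ) : Set where
  field
    block    : Family M q l
    deficit  : ∀ i → sum (λ t → k ∸ ∣ block i t ∣) ≡ m
    occurs   : ∀ S → occurrences block S ≡ ext k m ∣ S ∣
    disjoint : ∀ i {v t t′} → v ∈ block i t → v ∈ block i t′ → t ≡ t′

module Extend {k M q l m : ℕ} (P : Partial k M q l (suc m)) where
  open Partial P
  open ≡-Reasoning

  decode : Fin (2 ^ l) → Subset l
  decode = proj₁ ∘ code-surjective

  -- Rows are partitions, options are their blocks, and columns are subsets. The row totals are the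
  -- deficits `suc m`, so `D = suc m`, and the column totals match by `ext-absorb`.
  chosen : Σ[ c ∈ (Fin M → Fin q) ] (∀ i → 0 < k ∸ ∣ block i (c i) ∣) ×
             (∀ j → load (λ i t → code (block i t)) c j ≡ ext k m (suc ∣ decode j ∣))
  chosen = exactAssignment (suc m) (λ j → ext k m (suc ∣ decode j ∣)) (λ i t → code (block i t))
    (λ i t → k ∸ ∣ block i t ∣) z<s deficit λ j → begin
      sum (λ i → sum λ t → δ (code (block i t)) j * (k ∸ ∣ block i t ∣))
        ≡⟨ sum-cong (λ i → sum-cong λ t → term i t j) ⟩
      sum (λ i → sum λ t → ⟦ block i t ≟ˢ decode j ⟧ * (k ∸ ∣ decode j ∣))
        ≡⟨ sum-cong (λ i → *-distribʳ-sum (k ∸ ∣ decode j ∣) _) ⟨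
      sum (λ i → sum (λ t → ⟦ block i t ≟ˢ decode j ⟧) * (k ∸ ∣ decode j ∣))
        ≡⟨ *-distribʳ-sum (k ∸ ∣ decode j ∣) _ ⟨
      occurrences block (decode j) * (k ∸ ∣ decode j ∣)
        ≡⟨ cong (_* (k ∸ ∣ decode j ∣)) (occurs (decode j)) ⟩
      ext k (suc m) ∣ decode j ∣ * (k ∸ ∣ decode j ∣)
        ≡⟨ ext-absorb k m ∣ decode j ∣ ⟩
      suc m * ext k m (suc ∣ decode j ∣) ∎
    where
    term : ∀ i t j → δ (code (block i t)) j * (k ∸ ∣ block i t ∣) ≡ ⟦ block i t ≟ˢ decode j ⟧ * (k ∸ ∣ decode j ∣)
    term i t j with code-surjective {l} j
    ... | S , refl rewrite δ-code (block i t) S with block i t ≟ˢ S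
    ...   | yes refl = refl
    ...   | no _     = refl

  c : Fin M → Fin q
  c = proj₁ chosen

  chosen-count : ∀ S → sum (λ i → ⟦ block i (c i) ≟ˢ S ⟧) ≡ ext k m (suc ∣ S ∣)
  chosen-count S = begin
    sum (λ i → ⟦ block i (c i) ≟ˢ S ⟧)        ≡⟨ sum-cong (λ i → δ-code (block i (c i)) S) ⟨
    sum (λ i → δ (code (block i (c i))) (code S)) ≡⟨ proj₂ (proj₂ chosen) (code S) ⟩
    ext k m (suc ∣ decode (code S) ∣)
      ≡⟨ cong (λ T → ext k m (suc ∣ T ∣)) {decode (code S)} {S} (code-injective (proj₂ (code-surjective {l} (code S)))) ⟩
    ext k m (suc ∣ S ∣)                       ∎

  block′ : Family M q (suc l)
  block′ i t = does (c i Fin.≟ t) ∷ block i t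

  deficit′ : ∀ i → sum (λ t → k ∸ ∣ block′ i t ∣) ≡ m
  deficit′ i = +-cancelʳ-≡ 1 _ m (begin
    sum (λ t → k ∸ ∣ block′ i t ∣) + 1
      ≡⟨ cong (sum (λ t → k ∸ ∣ block′ i t ∣) +_) (sum-δ-1 (c i)) ⟨
    sum (λ t → k ∸ ∣ block′ i t ∣) + sum (δ (c i))
      ≡⟨ sum-distrib-+ (λ t → k ∸ ∣ block′ i t ∣) (δ (c i)) ⟨
    sum (λ t → k ∸ ∣ block′ i t ∣ + δ (c i) t)     ≡⟨ sum-cong drop ⟩
    sum (λ t → k ∸ ∣ block i t ∣)                  ≡⟨ deficit i ⟩
    suc m                                          ≡⟨ +-comm 1 m ⟩
    m + 1                                          ∎)
    where
    drop : ∀ t → k ∸ ∣ block′ i t ∣ + δ (c i) t ≡ k ∸ ∣ block i t ∣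
    drop t with c i Fin.≟ t
    -- The chosen weight is positive, so the truncated difference really drops by one.
    ... | yes refl = trans (+-comm _ 1) (sym (∸-suc {∣ block i (c i) ∣} {k} (0<n∸m⇒m<n k _ (proj₁ (proj₂ chosen) i))))
    ... | no _ = +-identityʳ _

  occurs-true : ∀ S → occurrences block′ (true ∷ S) ≡ ext k m (suc ∣ S ∣)
  occurs-true S = begin
    occurrences block′ (true ∷ S)
      ≡⟨ sum-cong (λ i → trans (sum-cong (term i)) (sum-δ (λ t → ⟦ block i t ≟ˢ S ⟧) (c i))) ⟩
    sum (λ i → ⟦ block i (c i) ≟ˢ S ⟧) ≡⟨ chosen-count S ⟩
    ext k m (suc ∣ S ∣) ∎
    where
    term : ∀ i t → ⟦ block′ i t ≟ˢ (true ∷ S) ⟧ ≡ δ (c i) t * ⟦ block i t ≟ˢ S ⟧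
    term i t with does (c i Fin.≟ t)
    ... | true  = sym (*-identityˡ _)
    ... | false = refl

  -- Each block equal to `S` turns into `true ∷ S` or `false ∷ S`. Both counts together give
  -- `ext k (suc m) ∣ S ∣`, and the recursion of `ext` leaves its first summand once `occurs-true`
  -- is cancelled.
  occurs-false : ∀ S → occurrences block′ (false ∷ S) ≡ ext k m ∣ S ∣
  occurs-false S = +-cancelʳ-≡ (ext k m (suc ∣ S ∣)) _ _ (begin
    occurrences block′ (false ∷ S) + ext k m (suc ∣ S ∣)
      ≡⟨ cong (occurrences block′ (false ∷ S) +_) (occurs-true S) ⟨
    occurrences block′ (false ∷ S) + occurrences block′ (true ∷ S)   ≡⟨ sum-distrib-+ _ _ ⟨
    sum (λ i → sum (λ t → ⟦ block′ i t ≟ˢ (false ∷ S) ⟧) + sum (λ t → ⟦ block′ i t ≟ˢ (true ∷ S) ⟧))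
      ≡⟨ sum-cong (λ i → trans (sym (sum-distrib-+ _ _)) (sum-cong (term i))) ⟩
    occurrences block S                                              ≡⟨ occurs S ⟩
    ext k (suc m) ∣ S ∣                                              ∎)
    where
    term : ∀ i t → ⟦ block′ i t ≟ˢ (false ∷ S) ⟧ + ⟦ block′ i t ≟ˢ (true ∷ S) ⟧ ≡ ⟦ block i t ≟ˢ S ⟧
    term i t with does (c i Fin.≟ t)
    ... | true  = refl
    ... | false = +-identityʳ _

  disjoint′ : ∀ i {v t t′} → v ∈ block′ i t → v ∈ block′ i t′ → t ≡ t′
  disjoint′ i {zero} {t} {t′} v∈t v∈t′ = trans (sym (head v∈t)) (head v∈t′)
    where
    head : ∀ {s} → zero ∈ block′ i s → c i ≡ s
    head {s} z∈ with c i Fin.≟ s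
    head here | yes eq = eq
  disjoint′ i {suc v} (there v∈t) (there v∈t′) = disjoint i v∈t v∈t′

  extend : Partial k M q (suc l) m
  extend = record
    { block = block′ ; deficit = deficit′
    ; occurs = λ { (true ∷ S) → occurs-true S ; (false ∷ S) → occurs-false S }
    ; disjoint = disjoint′ }

extendAll : ∀ {k M q} l m → Partial k M q l m → Partial k M q (m + l) 0
extendAll l zero    P = P
extendAll {k} {M} {q} l (suc m) P = subst (λ x → Partial k M q x 0) (+-suc m l) (extendAll (suc l) m (Extend.extend P))

-- Absorption at the empty set, with `k` cancelled. It supplies both the initial number of empty
-- blocks and the final number of edges.
edges-count : ∀ {n q} k → 1 ≤ k → 1 ≤ n → n ≡ q * k → ((n ∸ 1) C (k ∸ 1)) * q ≡ n C k
edges-count {suc n} {q} k 1≤k _ n≡qk = *-cancelʳ-≡ _ _ k {{>-nonZero 1≤k}} (begin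
  (n C (k ∸ 1)) * q * k      ≡⟨ *-assoc (n C (k ∸ 1)) q k ⟩
  (n C (k ∸ 1)) * (q * k)    ≡⟨ cong ((n C (k ∸ 1)) *_) n≡qk ⟨
  (n C (k ∸ 1)) * suc n      ≡⟨ *-comm (n C (k ∸ 1)) (suc n) ⟩
  suc n * (n C (k ∸ 1))      ≡⟨ cong (suc n *_) (ext≡C n 1≤k) ⟨
  suc n * ext k n 1          ≡⟨ ext-absorb k n 0 ⟨
  ext k (suc n) 0 * k        ≡⟨ cong (_* k) (ext≡C (suc n) z≤n) ⟩
  (suc n C k) * k            ∎)
  where open ≡-Reasoning

sum>0 : ∀ {n} (f : Fin n → ℕ) → 0 < sum f → ∃ λ i → 0 < f i
sum>0 {zero} f s>0 = contradiction (sym (sum-zero f)) (<⇒≢ s>0)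
sum>0 {suc n} f s>0 with f zero in eq
... | suc x = zero , subst (0 <_) (sym eq) z<s
... | zero with sum>0 (f ∘ suc) (subst (0 <_) (trans (sum-suc f) (cong (_+ sum (f ∘ suc)) eq)) s>0)
...   | i , fi>0 = suc i , fi>0

sum≤1-unique : ∀ {n} (f : Fin n → ℕ) → sum f ≤ 1 → ∀ {i j} → 0 < f i → 0 < f j → i ≡ j
sum≤1-unique f s≤1 {i} {j} fi>0 fj>0 with i Fin.≟ j
... | yes i≡j = i≡j
... | no i≢j = contradiction (begin
  2                                    ≤⟨ +-mono-≤ fi>0 fj>0 ⟩
  f i + f j                            ≡⟨ cong₂ _+_ (sum-δ f i) (sum-δ f j) ⟨
  sum (λ x → δ i x * f x) + sum (λ x → δ j x * f x) ≡⟨ sum-distrib-+ _ _ ⟨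
  sum (λ x → δ i x * f x + δ j x * f x) ≤⟨ sum-mono-≤ term ⟩
  sum f                                ≤⟨ s≤1 ⟩
  1                                    ∎) λ { (s≤s ()) }
  where
  open ≤-Reasoning
  term : ∀ x → δ i x * f x + δ j x * f x ≤ f x
  term x with i Fin.≟ x | j Fin.≟ x
  ... | yes refl | yes refl = contradiction refl i≢j
  ... | yes _    | no _     = ≤-reflexive (trans (+-identityʳ _) (*-identityˡ _))
  ... | no _     | yes _    = ≤-reflexive (*-identityˡ _)
  ... | no _     | no _     = z≤n

record Factorisation (n k M q : ℕ) : Set where
  field
    edge       : Family M q n
    edge-size  : ∀ i t → ∣ edge i t ∣ ≡ k
    edge-inj   : ∀ {i t i′ t′} → edge i t ≡ edge i′ t′ → i ≡ i′ × t ≡ t′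
    edge-surj  : ∀ e → ∣ e ∣ ≡ k → ∃₂ λ i t → edge i t ≡ e
    edge-disj  : ∀ i {v t t′} → v ∈ edge i t → v ∈ edge i t′ → t ≡ t′

-- All blocks start empty, with total deficit `q * k = n` in each partition. When no vertex is
-- missing, `ext k 0 s` is the indicator of `s = k`: every block has size `k`, and every `k`-set
-- occurs exactly once.
baranyai : ∀ {n q} k → 1 ≤ k → 1 ≤ n → n ≡ q * k → Factorisation n k ((n ∸ 1) C (k ∸ 1)) q
baranyai {n} {q} k 1≤k 1≤n n≡qk = record
  { edge = block ; edge-size = size ; edge-inj = inj ; edge-surj = surj ; edge-disj = disjoint }
  where
  M = (n ∸ 1) C (k ∸ 1)
  start : Partial k M q 0 n
  start = record
    { block    = λ _ _ → []
    ; deficit  = λ _ → trans (sum-const q k) (sym n≡qk)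
    ; occurs   = λ { [] → trans (trans (sum-cong {M} λ _ → sum-const q 1) (trans (sum-const M (q * 1)) (cong (M *_) (*-identityʳ q))))
                               (trans (edges-count k 1≤k 1≤n n≡qk) (sym (ext≡C n z≤n))) }
    ; disjoint = λ _ () }
  open Partial (subst (λ x → Partial k M q x 0) (+-identityʳ n) (extendAll 0 n start))
  occ>0 : ∀ {i t} {S : Subset n} → block i t ≡ S → 0 < occurrences block S
  occ>0 {i} {t} {S} eq = ≤-trans (≤-reflexive (sym (⟦⟧≡1 (block i t ≟ˢ S) eq)))
    (≤-trans (term≤sum (λ t → ⟦ block i t ≟ˢ S ⟧) t) (term≤sum (λ i → sum λ t → ⟦ block i t ≟ˢ S ⟧) i))
  size : ∀ i t → ∣ block i t ∣ ≡ k
  size i t = ⟦⟧>0 (∣ block i t ∣ ℕ.≟ k) (subst (0 <_) (occurs (block i t)) (occ>0 refl))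
  inj : ∀ {i t i′ t′} → block i t ≡ block i′ t′ → i ≡ i′ × t ≡ t′
  -- A total count of at most one first identifies the partitions, then the places within the
  -- partition.
  inj {i} {t} {i′} {t′} eq with sum≤1-unique (λ i → sum λ t → ⟦ block i t ≟ˢ S ⟧) once (row eq) (row refl)
    where
    S = block i′ t′
    once : occurrences block S ≤ 1
    once = ≤-trans (≤-reflexive (occurs S)) (⟦⟧≤1 (∣ S ∣ ℕ.≟ k))
    row : ∀ {i t} → block i t ≡ S → 0 < sum (λ t → ⟦ block i t ≟ˢ S ⟧)
    row {i} {t} eq = ≤-trans (≤-reflexive (sym (⟦⟧≡1 (block i t ≟ˢ S) eq))) (term≤sum (λ t → ⟦ block i t ≟ˢ S ⟧) t)
  ... | refl = refl , sum≤1-unique (λ t → ⟦ block i t ≟ˢ S ⟧) once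
          (≤-reflexive (sym (⟦⟧≡1 (block i t ≟ˢ S) eq))) (≤-reflexive (sym (⟦⟧≡1 (block i t′ ≟ˢ S) refl)))
    where
    S = block i t′
    once : sum (λ t → ⟦ block i t ≟ˢ S ⟧) ≤ 1
    once = ≤-trans (term≤sum (λ i → sum λ t → ⟦ block i t ≟ˢ S ⟧) i)
      (≤-trans (≤-reflexive (occurs S)) (⟦⟧≤1 (∣ S ∣ ℕ.≟ k)))
  surj : ∀ e → ∣ e ∣ ≡ k → ∃₂ λ i t → block i t ≡ e
  surj e ∣e∣≡k with sum>0 (λ i → sum λ t → ⟦ block i t ≟ˢ e ⟧)
    (subst (0 <_) (sym (trans (occurs e) (⟦⟧≡1 (∣ e ∣ ℕ.≟ k) ∣e∣≡k))) z<s)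
  ... | i , row>0 with sum>0 (λ t → ⟦ block i t ≟ˢ e ⟧) row>0
  ...   | t , hit = i , t , ⟦⟧>0 (block i t ≟ˢ e) hit

-- Greedy choice of distinct elements.

sum<n⇒∃0 : ∀ {n} (f : Fin n → ℕ) → sum f < n → ∃ λ i → f i ≡ 0
sum<n⇒∃0 {n} f s<n with Fin.any? (λ i → f i ℕ.≟ 0)
... | yes ∃0 = ∃0
... | no ∄0  = contradiction
  (≤-trans (≤-reflexive (sym (trans (sum-const n 1) (*-identityʳ n)))) (sum-mono-≤ λ i → n≢0⇒n>0 λ fi≡0 → ∄0 (i , fi≡0)))
  (<⇒≱ s<n)

-- A positive `F j t` forbids `t` at step `j`. The element chosen first is then forbidden in all
-- later rows: their sums grow by one while their indices drop by one, so the bound persists.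
greedy : ∀ {q} m (F : Fin m → Fin q → ℕ) → (∀ j → sum (F j) + toℕ j < q) →
         Σ[ g ∈ (Fin m → Fin q) ] (∀ j → F j (g j) ≡ 0) × Injective _≡_ _≡_ g
greedy zero F _ = (λ ()) , (λ ()) , λ { {()} }
greedy {q} (suc m) F few with sum<n⇒∃0 (F zero) (≤-trans (s≤s (m≤m+n _ _)) (few zero))
... | t₀ , F₀≡0 with greedy m (λ j t → F (suc j) t + δ t₀ t) few′
  where
  few′ : ∀ j → sum (λ t → F (suc j) t + δ t₀ t) + toℕ j < q
  few′ j = ≤-trans (s≤s (≤-reflexive (begin
    sum (λ t → F (suc j) t + δ t₀ t) + toℕ j ≡⟨ cong (_+ toℕ j) (sum-distrib-+ (F (suc j)) (δ t₀)) ⟩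
    sum (F (suc j)) + sum (δ t₀) + toℕ j     ≡⟨ cong (λ x → sum (F (suc j)) + x + toℕ j) (sum-δ-1 t₀) ⟩
    sum (F (suc j)) + 1 + toℕ j              ≡⟨ +-assoc (sum (F (suc j))) 1 (toℕ j) ⟩
    sum (F (suc j)) + suc (toℕ j)            ∎))) (few (suc j))
    where open ≡-Reasoning
...   | g , F≡0 , g-inj = g′ , (λ { zero → F₀≡0 ; (suc j) → m+n≡0⇒m≡0 _ (F≡0 j) }) , inj
  where
  g′ : Fin (suc m) → Fin q
  g′ zero    = t₀
  g′ (suc j) = g j
  fresh : ∀ j → t₀ ≢ g j
  fresh j eq = 1+n≢0 (trans (sym (⟦⟧≡1 (t₀ Fin.≟ g j) eq)) (m+n≡0⇒n≡0 (F (suc j) (g j)) (F≡0 j)))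
  inj : Injective _≡_ _≡_ g′
  inj {zero}  {zero}  _  = refl
  inj {zero}  {suc j} eq = contradiction eq (fresh j)
  inj {suc i} {zero}  eq = contradiction (sym eq) (fresh i)
  inj {suc i} {suc j} eq = cong suc (g-inj eq)

injective⇒surjective : ∀ {n} {f : Fin n → Fin n} → Injective _≡_ _≡_ f → ∀ y → ∃ λ x → f x ≡ y
injective⇒surjective {suc n} {f} f-inj y with Fin.any? (λ x → f x Fin.≟ y)
... | yes ∃x = ∃x
... | no ∄x  = contradiction
  (Fin.injective⇒≤ {f = λ x → punchOut (y≢f x)} (λ {i} {j} eq → f-inj (Fin.punchOut-injective (y≢f i) (y≢f j) eq)))
  1+n≰n
  where
  y≢f : ∀ x → y ≢ f x
  y≢f x eq = ∄x (x , sym eq)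

-- The involution keeping [0, c) and reversing [c, q): the greedy choice fills the
-- first c positions, then the others from the last one downwards.
flip : ℕ → ℕ → ℕ → ℕ
flip q c j with j <? c
... | yes _ = j
... | no _  = q + c ∸ suc j

flip-< : ∀ {q c j} → j < c → flip q c j ≡ j
flip-< {q} {c} {j} j<c with j <? c
... | yes _  = refl
... | no j≮c = contradiction j<c j≮c

flip-≥ : ∀ {q c j} → c ≤ j → j < q → flip q c j + suc j ≡ q + c
flip-≥ {q} {c} {j} c≤j j<q with j <? c
... | yes j<c = contradiction c≤j (<⇒≱ j<c)
... | no _    = m∸n+n≡m (≤-trans j<q (m≤m+n q c))

flip-≥c : ∀ {q c j} → c ≤ j → j < q → c ≤ flip q c j
flip-≥c {q} {c} {j} c≤j j<q = +-cancelʳ-≤ (suc j) c _ (begin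
  c + suc j            ≤⟨ +-monoʳ-≤ c j<q ⟩
  c + q                ≡⟨ +-comm c q ⟩
  q + c                ≡⟨ flip-≥ c≤j j<q ⟨
  flip q c j + suc j   ∎)
  where open ≤-Reasoning

flip<q : ∀ {q} c {j} → j < q → flip q c j < q
flip<q {q} c {j} j<q with ≤-<-connex c j
... | inj₂ j<c = subst (_< q) (sym (flip-< j<c)) j<q
... | inj₁ c≤j = +-cancelʳ-≤ j _ q (begin
  suc (flip q c j) + j ≡⟨ +-suc (flip q c j) j ⟨
  flip q c j + suc j   ≡⟨ flip-≥ c≤j j<q ⟩
  q + c                ≤⟨ +-monoʳ-≤ q c≤j ⟩
  q + j                ∎)
  where open ≤-Reasoning

flip-involutive : ∀ {q} c {j} → j < q → flip q c (flip q c j) ≡ j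
flip-involutive {q} c {j} j<q with ≤-<-connex c j
... | inj₂ j<c = trans (cong (flip q c) (flip-< j<c)) (flip-< j<c)
... | inj₁ c≤j = +-cancelʳ-≡ (suc (flip q c j)) _ j (begin
  flip q c (flip q c j) + suc (flip q c j)  ≡⟨ flip-≥ (flip-≥c c≤j j<q) (flip<q c j<q) ⟩
  q + c                                     ≡⟨ flip-≥ c≤j j<q ⟨
  flip q c j + suc j                        ≡⟨ +-suc (flip q c j) j ⟩
  suc (flip q c j) + j                      ≡⟨ +-comm (suc (flip q c j)) j ⟩
  j + suc (flip q c j)                      ∎)
  where open ≡-Reasoning

flipF : ∀ {q} → ℕ → Fin q → Fin q
flipF c j = fromℕ< (flip<q c (Fin.toℕ<n j))

toℕ-flipF : ∀ {q} c (j : Fin q) → toℕ (flipF c j) ≡ flip q c (toℕ j)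
toℕ-flipF c j = Fin.toℕ-fromℕ< _

flipF-involutive : ∀ {q} c (j : Fin q) → flipF c (flipF c j) ≡ j
flipF-involutive {q} c j = Fin.toℕ-injective (trans (toℕ-flipF c (flipF c j))
  (trans (cong (flip q c) (toℕ-flipF c j)) (flip-involutive c (Fin.toℕ<n j))))

-- Intersections of an edge with a matching.

meet : ∀ {n} → Subset n → Subset n → ℕ
meet S T = sum λ v → ⟦ v ∈? S ⟧ * ⟦ v ∈? T ⟧

meet-comm : ∀ {n} (S T : Subset n) → meet S T ≡ meet T S
meet-comm S T = sum-cong λ v → *-comm ⟦ v ∈? S ⟧ ⟦ v ∈? T ⟧

meet≢0 : ∀ {n} {S T : Subset n} {v} → v ∈ S → v ∈ T → meet S T ≢ 0
meet≢0 {S = S} {T} {v} v∈S v∈T eq = 1+n≰n (begin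
  1                                  ≡⟨ cong₂ _*_ (⟦⟧≡1 (v ∈? S) v∈S) (⟦⟧≡1 (v ∈? T) v∈T) ⟨
  ⟦ v ∈? S ⟧ * ⟦ v ∈? T ⟧            ≤⟨ term≤sum (λ v → ⟦ v ∈? S ⟧ * ⟦ v ∈? T ⟧) v ⟩
  meet S T                           ≡⟨ eq ⟩
  0                                  ∎)
  where open ≤-Reasoning

∣_∣≡sum : ∀ {n} (S : Subset n) → ∣ S ∣ ≡ sum (λ v → ⟦ v ∈? S ⟧)
∣ [] ∣≡sum        = sym (sum-zero _)
∣ true ∷ S ∣≡sum  = trans (cong suc ∣ S ∣≡sum) (sym (sum-suc _))
∣ false ∷ S ∣≡sum = trans ∣ S ∣≡sum (sym (sum-suc _))

unique⇒sum≤1 : ∀ {n} (f : Fin n → ℕ) → (∀ i → f i ≤ 1) → (∀ {i j} → 0 < f i → 0 < f j → i ≡ j) → sum f ≤ 1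
unique⇒sum≤1 {n} f f≤1 unique with Fin.any? (λ i → 0 <? f i)
... | no ∄i = ≤-trans (sum-mono-≤ λ i → ≮⇒≥ λ fi>0 → ∄i (i , fi>0))
                (≤-trans (≤-reflexive (trans (sum-const n 0) (*-zeroʳ n))) z≤n)
... | yes (i , fi>0) = ≤-trans (sum-mono-≤ f≤δ) (≤-reflexive (sum-δ-1 i))
  where
  f≤δ : ∀ j → f j ≤ δ i j
  f≤δ j with i Fin.≟ j
  ... | yes _  = f≤1 j
  ... | no i≢j = ≮⇒≥ λ fj>0 → i≢j (unique fi>0 fj>0)

Matching : ∀ {n q} → (Fin q → Subset n) → Set
Matching E = ∀ {v t t′} → v ∈ E t → v ∈ E t′ → t ≡ t′

-- Each vertex of `e` lies in at most one edge of the matching.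
sum-meet≤ : ∀ {n q} {E : Fin q → Subset n} → Matching E → ∀ e → sum (λ t → meet e (E t)) ≤ ∣ e ∣
sum-meet≤ {E = E} matching e = begin
  sum (λ t → sum λ v → ⟦ v ∈? e ⟧ * ⟦ v ∈? E t ⟧)   ≡⟨ sum-comm _ ⟩
  sum (λ v → sum λ t → ⟦ v ∈? e ⟧ * ⟦ v ∈? E t ⟧)   ≡⟨ sum-cong (λ v → *-distribˡ-sum ⟦ v ∈? e ⟧ _) ⟨
  sum (λ v → ⟦ v ∈? e ⟧ * sum (λ t → ⟦ v ∈? E t ⟧))
    ≤⟨ sum-mono-≤ (λ v → *-monoʳ-≤ ⟦ v ∈? e ⟧ (cover v)) ⟩
  sum (λ v → ⟦ v ∈? e ⟧ * 1)                        ≡⟨ sum-cong (λ v → *-identityʳ ⟦ v ∈? e ⟧) ⟩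
  sum (λ v → ⟦ v ∈? e ⟧)                            ≡⟨ ∣ e ∣≡sum ⟨
  ∣ e ∣                                             ∎
  where
  open ≤-Reasoning
  cover : ∀ v → sum (λ t → ⟦ v ∈? E t ⟧) ≤ 1
  cover v = unique⇒sum≤1 _ (λ t → ⟦⟧≤1 (v ∈? E t))
    λ {t} {t′} p p′ → matching (⟦⟧>0 (v ∈? E t) p) (⟦⟧>0 (v ∈? E t′) p′)

-- Reordering one matching against two others.

⟦⟧-mono : ∀ {a b} {A : Set a} {B : Set b} (A? : Dec A) (B? : Dec B) → (A → B) → ⟦ A? ⟧ ≤ ⟦ B? ⟧
⟦⟧-mono (yes a) B? f = ≤-reflexive (sym (⟦⟧≡1 B? (f a)))
⟦⟧-mono (no _)  B? f = z≤n

count-< : ∀ q x → sum {q} (λ i → ⟦ toℕ i <? x ⟧) ≤ x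
count-< zero    x       = ≤-trans (≤-reflexive (sum-zero _)) z≤n
count-< (suc q) zero    = ≤-reflexive (trans (sum-const (suc q) 0) (*-zeroʳ (suc q)))
count-< (suc q) (suc x) = ≤-trans (≤-reflexive (sum-suc _)) (s≤s (count-< q x))

count-≥ : ∀ q x → sum {q} (λ i → ⟦ x ≤? toℕ i ⟧) ≤ q ∸ x
count-≥ q       zero    = sum≤n λ _ → ≤-refl
count-≥ zero    (suc x) = ≤-reflexive (sum-zero _)
count-≥ (suc q) (suc x) = ≤-trans (≤-reflexive (sum-suc _))
  (≤-trans (sum-mono-≤ {q} λ i → ⟦⟧-mono (suc x ≤? suc (toℕ i)) (x ≤? toℕ i) s≤s⁻¹) (count-≥ q x))

-- When the blocks u and v of q edges are r apart, some window of (r − 1) q + L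
-- edges contains position p of u and position p′ of v iff p′ + q < p + L.
Compatible : ∀ {n q} → ℕ → (u v : Fin q → Subset n) → Set
Compatible {q = q} L u v = ∀ p p′ → toℕ p′ + q < toℕ p + L → meet (u p) (v p′) ≡ 0

-- At step j, filling position p, at most a − p − 1 edges of the earlier matching and
-- p + b − q edges of the later one each forbid at most k edges.
FewForbidden : (k q a b c : ℕ) → Set
FewForbidden k q a b c = ∀ {j} → j < q → let p = flip q c j in
  k * (a ∸ suc p) + k * (p + b ∸ q) + j < q

module Reorder {n k q} (E : Fin q → Subset n) (matching : Matching E)
  (U W : Fin q → Subset n) (∣U∣≤k : ∀ p → ∣ U p ∣ ≤ k) (∣W∣≤k : ∀ p → ∣ W p ∣ ≤ k) (a b c : ℕ)
  (few : FewForbidden k q a b c) where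

  -- Each vanishes exactly when `E t` may stand at position `p` with respect to `U` or `W`.
  -- Intersection sizes are added up, which bounds the number of forbidden `t` from above.
  before after : ℕ → Fin q → ℕ
  before p t = sum λ p′ → ⟦ p + q <? toℕ p′ + a ⟧ * meet (U p′) (E t)
  after  p t = sum λ p′ → ⟦ toℕ p′ + q <? p + b ⟧ * meet (W p′) (E t)

  -- Summing over `t` first, each `V p′` contributes at most its size by `sum-meet≤`.
  weigh : ∀ (f : Fin q → ℕ) (V : Fin q → Subset n) → (∀ p → ∣ V p ∣ ≤ k) → ∀ {x} → sum f ≤ x →
          sum (λ t → sum λ p′ → f p′ * meet (V p′) (E t)) ≤ k * x
  weigh f V ∣V∣≤k {x} f≤x = begin
    sum (λ t → sum λ p′ → f p′ * meet (V p′) (E t))  ≡⟨ sum-comm _ ⟩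
    sum (λ p′ → sum λ t → f p′ * meet (V p′) (E t))  ≡⟨ sum-cong (λ p′ → *-distribˡ-sum (f p′) _) ⟨
    sum (λ p′ → f p′ * sum (λ t → meet (V p′) (E t)))
      ≤⟨ sum-mono-≤ (λ p′ → *-monoʳ-≤ (f p′) (≤-trans (sum-meet≤ matching (V p′)) (∣V∣≤k p′))) ⟩
    sum (λ p′ → f p′ * k)                            ≡⟨ *-distribʳ-sum k f ⟨
    sum f * k                                        ≤⟨ *-monoˡ-≤ k f≤x ⟩
    x * k                                            ≡⟨ *-comm x k ⟩
    k * x                                            ∎
    where open ≤-Reasoning

  before-few : ∀ p → sum (before p) ≤ k * (a ∸ suc p)
  before-few p = weigh _ U ∣U∣≤k (begin
    sum (λ p′ → ⟦ p + q <? toℕ p′ + a ⟧)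
      ≤⟨ sum-mono-≤ (λ p′ → ⟦⟧-mono (p + q <? toℕ p′ + a) (suc (p + q) ∸ a ≤? toℕ p′) (λ lt → ≤-trans (∸-monoˡ-≤ a lt) (≤-reflexive (m+n∸n≡m (toℕ p′) a)))) ⟩
    sum {q} (λ p′ → ⟦ suc (p + q) ∸ a ≤? toℕ p′ ⟧)   ≤⟨ count-≥ q (suc (p + q) ∸ a) ⟩
    q ∸ (suc (p + q) ∸ a)
      ≤⟨ m≤n+o⇒m∸n≤o q (suc (p + q) ∸ a) (+-cancelˡ-≤ (suc p) _ _ lem) ⟩
    a ∸ suc p                                        ∎)
    where
    open ≤-Reasoning
    -- Two applications of `m≤n+m∸n` keep the estimate valid even where one of the differences
    -- truncates.
    lem : suc p + q ≤ suc p + (suc (p + q) ∸ a + (a ∸ suc p))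
    lem = begin
      suc p + q                                     ≤⟨ m≤n+m∸n (suc p + q) a ⟩
      a + (suc p + q ∸ a)                           ≤⟨ +-monoˡ-≤ _ (m≤n+m∸n a (suc p)) ⟩
      suc p + (a ∸ suc p) + (suc p + q ∸ a)         ≡⟨ +-assoc (suc p) (a ∸ suc p) _ ⟩
      suc p + (a ∸ suc p + (suc p + q ∸ a))         ≡⟨ cong (suc p +_) (+-comm (a ∸ suc p) _) ⟩
      suc p + (suc (p + q) ∸ a + (a ∸ suc p))       ∎

  after-few : ∀ p → sum (after p) ≤ k * (p + b ∸ q)
  after-few p = weigh _ W ∣W∣≤k (≤-trans
    (sum-mono-≤ λ p′ → ⟦⟧-mono (toℕ p′ + q <? p + b) (toℕ p′ <? p + b ∸ q) (m+n≤o⇒m≤o∸n (suc (toℕ p′))))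
    (count-< q (p + b ∸ q)))

  position : Fin q → ℕ
  position j = toℕ (flipF c j)

  chosen : Σ[ g ∈ (Fin q → Fin q) ] (∀ j → before (position j) (g j) + after (position j) (g j) ≡ 0) × Injective _≡_ _≡_ g
  chosen = greedy q (λ j t → before (position j) t + after (position j) t) λ j →
    ≤-trans (s≤s (+-monoˡ-≤ (toℕ j) (≤-trans (≤-reflexive (sum-distrib-+ (before (position j)) (after (position j))))
      (+-mono-≤ (before-few (position j)) (after-few (position j))))))
      (subst (λ p → k * (a ∸ suc p) + k * (p + b ∸ q) + toℕ j < q) (sym (toℕ-flipF c j)) (few (Fin.toℕ<n j)))

  -- The greedy choice is indexed by steps; the involution converts a position into the step that
  -- fills it.
  order : Fin q → Fin q
  order = proj₁ chosen ∘ flipF c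

  order-injective : Injective _≡_ _≡_ order
  order-injective {i} {j} eq = trans (sym (flipF-involutive c i))
    (trans (cong (flipF c) (proj₂ (proj₂ chosen) eq)) (flipF-involutive c j))

  avoids : ∀ p → before (toℕ p) (order p) + after (toℕ p) (order p) ≡ 0
  avoids p = subst (λ x → before (toℕ x) (order p) + after (toℕ x) (order p) ≡ 0)
    (flipF-involutive c p) (proj₁ (proj₂ chosen) (flipF c p))

  vanish : ∀ {ℓ} {A : Set ℓ} (A? : Dec A) {m} → A → ⟦ A? ⟧ * m ≤ 0 → m ≡ 0
  vanish A? {m} x le = n≤0⇒n≡0 (≤-trans (≤-reflexive (sym (trans (cong (_* m) (⟦⟧≡1 A? x)) (*-identityˡ m)))) le)

  U-compatible : Compatible a U (E ∘ order)
  U-compatible p′ p lt = vanish (toℕ p + q <? toℕ p′ + a) lt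
    (≤-trans (term≤sum (λ p′ → ⟦ toℕ p + q <? toℕ p′ + a ⟧ * meet (U p′) (E (order p))) p′)
      (≤-reflexive (m+n≡0⇒m≡0 _ (avoids p))))

  W-compatible : Compatible b (E ∘ order) W
  W-compatible p p′ lt = trans (meet-comm (E (order p)) (W p′)) (vanish (toℕ p′ + q <? toℕ p + b) lt
    (≤-trans (term≤sum (λ p′ → ⟦ toℕ p′ + q <? toℕ p + b ⟧ * meet (W p′) (E (order p))) p′)
      (≤-reflexive (m+n≡0⇒n≡0 (before (toℕ p) (order p)) (avoids p)))))

-- Reordering all matchings in turn.

module Arrange {n k q} (E : ℕ → Fin q → Subset n) (matching : ∀ i → Matching (E i))
  (∣E∣≤k : ∀ i t → ∣ E i t ∣ ≤ k) (u w : ℕ → ℕ) (a b c : ℕ)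
  (few : FewForbidden k q a b c) where

  -- A condition linking two matchings is imposed when the one of larger index is processed, against
  -- the order already fixed for the other.
  record Arranged (m : ℕ) : Set where
    field
      ρ     : ℕ → Fin q → Fin q
      ρ-inj : ∀ i → Injective _≡_ _≡_ (ρ i)
      back  : ∀ i → i < m → u i < i → Compatible a (E (u i) ∘ ρ (u i)) (E i ∘ ρ i)
      forth : ∀ i → i < m → w i < i → Compatible b (E i ∘ ρ i) (E (w i) ∘ ρ (w i))

  arrange : ∀ m → Arranged m
  arrange zero    = record { ρ = λ _ → id ; ρ-inj = λ _ → id ; back = λ _ () ; forth = λ _ () }
  arrange (suc m) = record { ρ = ρ′ ; ρ-inj = ρ′-inj ; back = back′ ; forth = forth′ }
    where
    open Arranged (arrange m)
    open Reorder (E m) (matching m) (E (u m) ∘ ρ (u m)) (E (w m) ∘ ρ (w m))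
      (λ p → ∣E∣≤k (u m) _) (λ p → ∣E∣≤k (w m) _) a b c few
    ρ′ : ℕ → Fin q → Fin q
    ρ′ i with i ℕ.≟ m
    ... | yes _ = order
    ... | no _  = ρ i
    new : ρ′ m ≡ order
    new with m ℕ.≟ m
    ... | yes _  = refl
    ... | no m≢m = contradiction refl m≢m
    old : ∀ {i} → i < m → ρ′ i ≡ ρ i
    old {i} i<m with i ℕ.≟ m
    ... | yes refl = contradiction i<m (<-irrefl refl)
    ... | no _     = refl
    ρ′-inj : ∀ i → Injective _≡_ _≡_ (ρ′ i)
    ρ′-inj i with i ℕ.≟ m
    ... | yes _ = order-injective
    ... | no _  = ρ-inj i
    back′ : ∀ i → i < suc m → u i < i → Compatible a (E (u i) ∘ ρ′ (u i)) (E i ∘ ρ′ i)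
    back′ i i≤m u<i with m≤n⇒m<n∨m≡n (s≤s⁻¹ i≤m)
    ... | inj₁ i<m rewrite old i<m | old (<-trans u<i i<m) = back i i<m u<i
    ... | inj₂ refl rewrite new | old u<i = U-compatible
    forth′ : ∀ i → i < suc m → w i < i → Compatible b (E i ∘ ρ′ i) (E (w i) ∘ ρ′ (w i))
    forth′ i i≤m w<i with m≤n⇒m<n∨m≡n (s≤s⁻¹ i≤m)
    ... | inj₁ i<m rewrite old i<m | old (<-trans w<i i<m) = forth i i<m w<i
    ... | inj₂ refl rewrite new | old w<i = W-compatible

-- Counting hits below a bound.

countBelow-cong : ∀ s {P Q : ℕ → Bool} → (∀ j → P j ≡ Q j) → countBelow s P ≡ countBelow s Q
countBelow-cong zero    P≡Q = refl
countBelow-cong (suc s) P≡Q = cong₂ (λ x b → x + (if b then 1 else 0)) (countBelow-cong s P≡Q) (P≡Q s)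

countBelow-first : ∀ s P → countBelow s P ≡ 0 ⊎
  ∃ λ j₀ → j₀ < s × P j₀ ≡ true × (∀ j → j < s → P j ≡ true → j₀ ≤ j)
countBelow-first zero P = inj₁ refl
countBelow-first (suc s) P with countBelow-first s P
... | inj₂ (j₀ , j₀<s , Pj₀ , first) = inj₂ (j₀ , m<n⇒m<1+n j₀<s , Pj₀ , first′)
  where
  first′ : ∀ j → j < suc s → P j ≡ true → j₀ ≤ j
  first′ j j≤s Pj with m≤n⇒m<n∨m≡n (s≤s⁻¹ j≤s)
  ... | inj₁ j<s  = first j j<s Pj
  ... | inj₂ refl = <⇒≤ j₀<s
... | inj₁ none with P s in Ps
...   | false = inj₁ (trans (+-identityʳ _) none)
...   | true  = inj₂ (s , ≤-refl , Ps , first)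
  where
  hit : ∀ {s} j → j < s → P j ≡ true → countBelow s P ≢ 0
  hit {suc s} j j≤s Pj none with m≤n⇒m<n∨m≡n (s≤s⁻¹ j≤s)
  ... | inj₁ j<s  = hit j j<s Pj (m+n≡0⇒m≡0 _ none)
  ... | inj₂ refl rewrite Pj = 1+n≢0 (m+n≡0⇒n≡0 (countBelow s P) none)
  first : ∀ j → j < suc s → P j ≡ true → s ≤ j
  first j j≤s Pj = ≮⇒≥ λ j<s → hit j j<s Pj none

-- A strictly increasing `β` injects the hits into the interval from `lo` to `hi`. At a hit in `s`,
-- the induction continues with `β s` as the upper end.
countBelow-increasing : ∀ s {P} {β : ℕ → ℕ} {lo hi} → lo ≤ hi →
  (∀ j → j < s → P j ≡ true → lo ≤ β j × β j < hi) →
  (∀ {j j′} → j < j′ → j′ < s → P j ≡ true → P j′ ≡ true → β j < β j′) →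
  countBelow s P + lo ≤ hi
countBelow-increasing zero lo≤hi _ _ = lo≤hi
countBelow-increasing (suc s) {P} {β} {lo} {hi} lo≤hi range incr with P s in Ps
... | false = ≤-trans (≤-reflexive (cong (_+ lo) (+-identityʳ _))) (countBelow-increasing s lo≤hi
    (λ j j<s → range j (m<n⇒m<1+n j<s)) (λ j<j′ j′<s → incr j<j′ (m<n⇒m<1+n j′<s)))
... | true = begin
  countBelow s P + 1 + lo    ≡⟨ cong (_+ lo) (+-comm _ 1) ⟩
  suc (countBelow s P + lo)  ≤⟨ s≤s (countBelow-increasing s (proj₁ (range s ≤-refl Ps))
                                  (λ j j<s Pj → proj₁ (range j (m<n⇒m<1+n j<s) Pj) , incr j<s ≤-refl Pj Ps)
                                  (λ j<j′ j′<s → incr j<j′ (m<n⇒m<1+n j′<s))) ⟩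
  suc (β s)                  ≤⟨ proj₂ (range s ≤-refl Ps) ⟩
  hi                         ∎
  where open ≤-Reasoning

-- The degree of a vertex in a window.

toℕ-mod : ∀ y q .{{_ : NonZero q}} → toℕ (y mod q) ≡ y % q
toℕ-mod y q = Fin.toℕ-fromℕ< _

divMod-injective : ∀ {y y′} q .{{_ : NonZero q}} → y / q ≡ y′ / q → y mod q ≡ y′ mod q → y ≡ y′
divMod-injective {y} {y′} q quot rem = begin
  y                      ≡⟨ m≡m%n+[m/n]*n y q ⟩
  y % q + y / q * q
    ≡⟨ cong₂ (λ x z → x + z * q) (trans (sym (toℕ-mod y q)) (trans (cong toℕ rem) (toℕ-mod y′ q))) quot ⟩
  y′ % q + y′ / q * q    ≡⟨ m≡m%n+[m/n]*n y′ q ⟨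
  y′                     ∎
  where open ≡-Reasoning

-- `r′` stands for `r ∸ 1`. The matchings form an infinite sequence, so that a window running past
-- the end of the cycle is still an interval.
module Window {n q} .{{_ : NonZero q}} (G : ℕ → Fin q → Subset n) (matching : ∀ β → Matching (G β))
  (r′ L : ℕ) (L≤q : L ≤ q) where

  edgeAt : ℕ → Subset n
  edgeAt y = G (y / q) (y mod q)

  -- Within one block the two edges would coincide, since they share `v`.
  blocks-increase : ∀ {y y′ v} → y < y′ → v ∈ edgeAt y → v ∈ edgeAt y′ → y / q < y′ / q
  blocks-increase {y} {y′} {v} y<y′ v∈y v∈y′ = ≤∧≢⇒< (/-monoˡ-≤ q (<⇒≤ y<y′)) λ eq →
    <⇒≢ y<y′ (divMod-injective q eq (matching (y / q) v∈y (subst (λ β → v ∈ G β (y′ mod q)) (sym eq) v∈y′)))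

  -- Let the blocks be `suc r′ + e` apart. If `e = 0`, the positions satisfy the inequality in
  -- `Compatible`, so the edges cannot share `v`. If `e` is positive, the distance is too large
  -- because `L ≤ q`.
  blocks-close : ∀ {y y′ v} → y′ < y + (r′ * q + L) →
    (y / q + suc r′ ≡ y′ / q → Compatible L (G (y / q)) (G (y / q + suc r′))) →
    v ∈ edgeAt y → v ∈ edgeAt y′ → y′ / q < y / q + suc r′
  blocks-close {y} {y′} {v} near compatible v∈y v∈y′ = ≰⇒> λ far → absurd _ (m+[n∸m]≡n far)
    where
    β = y / q
    gap : ∀ e → β + suc r′ + e ≡ y′ / q → y′ % q + q + e * q < y % q + L
    gap e eq = +-cancelʳ-< ((β + r′) * q) _ _ (begin-strict
      y′ % q + q + e * q + (β + r′) * q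
        ≡⟨ solve 5 (λ p q e β r → p :+ q :+ e :* q :+ (β :+ r) :* q := p :+ (β :+ (con 1 :+ r) :+ e) :* q) refl (y′ % q) q e β r′ ⟩
      y′ % q + (β + suc r′ + e) * q        ≡⟨ cong (λ x → y′ % q + x * q) eq ⟩
      y′ % q + y′ / q * q                  ≡⟨ m≡m%n+[m/n]*n y′ q ⟨
      y′                                   <⟨ near ⟩
      y + (r′ * q + L)                     ≡⟨ cong (_+ (r′ * q + L)) (m≡m%n+[m/n]*n y q) ⟩
      y % q + β * q + (r′ * q + L)
        ≡⟨ solve 5 (λ p q L β r → p :+ β :* q :+ (r :* q :+ L) := p :+ L :+ (β :+ r) :* q) refl (y % q) q L β r′ ⟩
      y % q + L + (β + r′) * q             ∎)
      where
      open ≤-Reasoning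
      open +-*-Solver
    absurd : ∀ e → β + suc r′ + e ≢ y′ / q
    absurd zero eq = meet≢0 v∈y (subst (λ x → v ∈ G x (y′ mod q)) (sym eq′) v∈y′)
      (compatible eq′ (y mod q) (y′ mod q)
        (subst₂ (λ x x′ → x′ + q < x + L) (sym (toℕ-mod y q)) (sym (toℕ-mod y′ q))
          (≤-trans (s≤s (≤-reflexive (sym (+-identityʳ _)))) (gap 0 eq))))
      where
      eq′ : β + suc r′ ≡ y′ / q
      eq′ = trans (sym (+-identityʳ _)) eq
    absurd (suc e) eq = <-irrefl refl (begin-strict
      q + q                        ≤⟨ +-mono-≤ (m≤n+m q (y′ % q)) (m≤m+n q (e * q)) ⟩
      y′ % q + q + (q + e * q)     <⟨ gap (suc e) eq ⟩
      y % q + L                    ≤⟨ +-mono-≤ (m%n≤n y q) L≤q ⟩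
      q + q                        ∎)
      where open ≤-Reasoning

  -- Counted from the first edge containing `v`, the blocks of the edges through `v` increase
  -- strictly and stay within `suc r′` consecutive values. Compatibility is demanded only where
  -- block `β + suc r′` begins before the window ends.
  degree≤ : ∀ x₀ → (∀ β → (β + suc r′) * q < x₀ + (r′ * q + L) → Compatible L (G β) (G (β + suc r′))) →
    ∀ v → countBelow (r′ * q + L) (λ j → does (v ∈? edgeAt (x₀ + j))) ≤ suc r′
  degree≤ x₀ compatible v with countBelow-first (r′ * q + L) (λ j → does (v ∈? edgeAt (x₀ + j)))
  ... | inj₁ none = ≤-trans (≤-reflexive none) z≤n
  ... | inj₂ (j₀ , j₀<s , v∈j₀ , first) = +-cancelʳ-≤ ((x₀ + j₀) / q) _ _ (≤-trans
      (countBelow-increasing (r′ * q + L) {β = λ j → (x₀ + j) / q} (m≤m+n _ (suc r′))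
        (λ j j<s v∈j → /-monoˡ-≤ q (+-monoʳ-≤ x₀ (first j j<s v∈j)) , close j j<s v∈j)
        (λ {j} {j′} j<j′ j′<s v∈j v∈j′ → blocks-increase (+-monoʳ-< x₀ j<j′) (mem j v∈j) (mem j′ v∈j′)))
      (≤-reflexive (+-comm _ (suc r′))))
    where
    mem : ∀ j → does (v ∈? edgeAt (x₀ + j)) ≡ true → v ∈ edgeAt (x₀ + j)
    mem j eq with yes v∈ ← v ∈? edgeAt (x₀ + j) = v∈
    close : ∀ j → j < r′ * q + L → does (v ∈? edgeAt (x₀ + j)) ≡ true → (x₀ + j) / q < (x₀ + j₀) / q + suc r′
    close j j<s v∈j = blocks-close
      (≤-trans (+-monoʳ-< x₀ j<s) (+-monoˡ-≤ (r′ * q + L) (m≤m+n x₀ j₀)))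
      (λ eq → compatible _ (≤-trans (s≤s (≤-trans (≤-reflexive (cong (_* q) eq)) (m/n*n≤m (x₀ + j) q))) (+-monoʳ-< x₀ j<s)))
      (mem j₀ v∈j₀) (mem j v∈j)

-- The ordering that lists the matchings one after another.

toℕ-shift : ∀ {N} .{{_ : NonZero N}} (i : Fin N) j → toℕ (shift i j) ≡ (toℕ i + j) % N
toℕ-shift {suc N} i j = toℕ-mod (toℕ i + j) (suc N)

module Concatenate {n k M q} .{{_ : NonZero M}} .{{_ : NonZero q}} (F : Factorisation n k M q)
  (count : M * q ≡ n C k) where
  open Factorisation F

  E : ℕ → Fin q → Subset n
  E i = edge (i mod M)

  module _ (ρ : ℕ → Fin q → Fin q) (ρ-inj : ∀ i → Injective _≡_ _≡_ (ρ i)) where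

    -- The matching and its order are both taken at `β % M`, which makes the sequence periodic.
    G : ℕ → Fin q → Subset n
    G β p = E (β % M) (ρ (β % M) p)

    G-matching : ∀ β → Matching (G β)
    G-matching β v∈ v∈′ = ρ-inj (β % M) (edge-disj ((β % M) mod M) v∈ v∈′)

    edgeAt : ℕ → Subset n
    edgeAt y = G (y / q) (y mod q)

    instance
      Mq≢0 : NonZero (M * q)
      Mq≢0 = m*n≢0 M q

    edgeAt-% : ∀ y → edgeAt (y % (M * q)) ≡ edgeAt y
    edgeAt-% y = cong₂ (λ β p → E β (ρ β p))
      (trans (cong (_% M) (m%[n*o]/o≡m/o%n y M q)) (m%n%n≡m%n (y / q) M))
      (Fin.toℕ-injective (trans (toℕ-mod (y % (M * q)) q)
        (trans (m∣n⇒o%n%m≡o%m q (M * q) y (n∣m*n M)) (sym (toℕ-mod y q)))))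

    edgeAt-injective : ∀ {y y′} → y < M * q → y′ < M * q → edgeAt y ≡ edgeAt y′ → y ≡ y′
    edgeAt-injective {y} {y′} y< y′< eq with edge-inj eq
    ... | blocks , places = divMod-injective q quot
        (ρ-inj (y / q % M) (trans places (cong (λ β → ρ (β % M) (y′ mod q)) (sym quot))))
      where
      index : ∀ {x} → x < M * q → toℕ ((x / q % M) mod M) ≡ x / q
      index {x} x< = trans (toℕ-mod (x / q % M) M) (trans (m%n%n≡m%n (x / q) M) (m<n⇒m%n≡m (m<n*o⇒m/o<n x<)))
      quot : y / q ≡ y′ / q
      quot = trans (sym (index y<)) (trans (cong toℕ blocks) (index y′<))

    edgeAt-surjective : ∀ e → ∣ e ∣ ≡ k → ∃ λ y → y < M * q × edgeAt y ≡ e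
    edgeAt-surjective e ∣e∣≡k with edge-surj e ∣e∣≡k
    ... | i , t , refl with injective⇒surjective (ρ-inj (toℕ i)) t
    ...   | p , refl = y , y< , trans (cong₂ (λ β x → E β (ρ β x)) block place)
          (cong (λ x → edge x (ρ (toℕ i) p)) (Fin.toℕ-injective (trans (toℕ-mod (toℕ i) M) (m<n⇒m%n≡m (Fin.toℕ<n i)))))
      where
      y = toℕ p + toℕ i * q
      y< : y < M * q
      y< = ≤-trans (+-monoˡ-< (toℕ i * q) (Fin.toℕ<n p)) (*-monoˡ-≤ q (Fin.toℕ<n i))
      block : y / q % M ≡ toℕ i
      block = trans (cong (_% M) (trans (+-distrib-/-∣ʳ (toℕ p) (n∣m*n (toℕ i)))
        (cong₂ _+_ (m<n⇒m/n≡0 (Fin.toℕ<n p)) (m*n/n≡m (toℕ i) q)))) (m<n⇒m%n≡m (Fin.toℕ<n i))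
      place : y mod q ≡ p
      place = Fin.toℕ-injective (trans (toℕ-mod y q) (trans ([m+kn]%n≡m%n (toℕ p) (toℕ i) q) (m<n⇒m%n≡m (Fin.toℕ<n p))))

    <Mq : (x : Fin (n C k)) → toℕ x < M * q
    <Mq x = ≤-trans (Fin.toℕ<n x) (≤-reflexive (sym count))

    ordering : Ordering n k
    ordering = record
      { σ          = edgeAt ∘ toℕ
      ; isEdge     = λ _ → edge-size _ _
      ; injective  = λ {x} {y} eq → Fin.toℕ-injective (edgeAt-injective (<Mq x) (<Mq y) eq)
      ; surjective = λ e ∣e∣≡k → let y , y< , eq = edgeAt-surjective e ∣e∣≡k
                                     y<N = ≤-trans y< (≤-reflexive count) in
                       fromℕ< y<N , trans (cong edgeAt (Fin.toℕ-fromℕ< y<N)) eq }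

    edgeAt-shift : ∀ (i : Fin (n C k)) j → σ ordering (shift i j) ≡ edgeAt (toℕ i + j)
    edgeAt-shift i j = trans (cong edgeAt (shifted i)) (edgeAt-% (toℕ i + j))
      where
      shifted : (i : Fin (n C k)) → toℕ (shift i j) ≡ (toℕ i + j) % (M * q)
      -- The index is bound after the rewrite, since its type mentions `n C k`.
      shifted rewrite sym count = λ i → toℕ-shift i j

    regular : ∀ r′ L → L ≤ q → ∀ i →
      (∀ β → (β + suc r′) * q < toℕ i + (r′ * q + L) → Compatible L (G β) (G (β + suc r′))) →
      WindowRegular (σ ordering) (suc r′) i (r′ * q + L)
    regular r′ L L≤q i compatible v = ≤-trans
      (≤-reflexive (countBelow-cong (r′ * q + L) λ j → cong (λ e → does (v ∈? e)) (edgeAt-shift i j)))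
      (Window.degree≤ G G-matching r′ L L≤q (toℕ i) compatible v)

-- Inequalities for the greedy choice.

-- With `d = a ∸ suc p` positive, `k * d + p` is at most `k * (d + p) = k * (a ∸ 1)`; otherwise only
-- `p < q` is left.
few-suffix : ∀ {k q a p} → 1 ≤ k → (a ∸ 1) * k < q → p < q → k * (a ∸ suc p) + p < q
few-suffix {k} {q} {a} {p} 1≤k small p<q with a ≤? suc p
... | yes a≤ = ≤-trans (s≤s (≤-reflexive (cong (_+ p) (trans (cong (k *_) (m≤n⇒m∸n≡0 a≤)) (*-zeroʳ k))))) p<q
... | no a≰ with m≤n⇒∃[o]m+o≡n (<⇒≤ (≰⇒> a≰))
...   | d , refl = begin-strict
  k * (suc p + d ∸ suc p) + p  ≡⟨ cong (λ x → k * x + p) (m+n∸m≡n (suc p) d) ⟩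
  k * d + p                    ≤⟨ +-monoʳ-≤ (k * d) (m≤n*m p k {{>-nonZero 1≤k}}) ⟩
  k * d + k * p                ≡⟨ solve 3 (λ k d p → k :* d :+ k :* p := (p :+ d) :* k) refl k d p ⟩
  (p + d) * k                  <⟨ small ⟩
  q                            ∎
  where
  open ≤-Reasoning
  open +-*-Solver

-- For `c = q` the involution is the identity, so step `j` fills position `j`, and `b = 0` removes
-- the term of the later matching.
linear-few : ∀ {k q a} → 1 ≤ k → (a ∸ 1) * k < q → FewForbidden k q a 0 q
linear-few {k} {q} {a} 1≤k small {j} j<q
  rewrite flip-< {q} {q} j<q | +-identityʳ j | m≤n⇒m∸n≡0 (<⇒≤ j<q) | *-zeroʳ k | +-identityʳ (k * (a ∸ suc j)) =
  few-suffix {k} {q} {a} 1≤k small j<q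

ends-disjoint : ∀ {k q c j} → 1 ≤ k → c * (k + 1) < q → j < c → j + suc c ≤ q
ends-disjoint {k} {q} {c} {j} 1≤k small j<c = begin
  j + suc c    ≡⟨ +-suc j c ⟩
  suc j + c    ≤⟨ +-monoˡ-≤ c j<c ⟩
  c + c        ≡⟨ solve 1 (λ c → c :+ c := c :* (con 1 :+ con 1)) refl c ⟩
  c * (1 + 1)  ≤⟨ *-monoʳ-≤ c (+-monoˡ-≤ 1 1≤k) ⟩
  c * (k + 1)  ≤⟨ <⇒≤ small ⟩
  q            ∎
  where
  open ≤-Reasoning
  open +-*-Solver

-- The first `c` steps fill positions constrained only by the earlier matching. A later step `c + e`
-- fills a position at or beyond `c`, constrained only by the later matching; if its last edges
-- interfere there, the number of its forbidding edges is `d = c ∸ e`, and `k * d + c + e` is at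
-- most `k * c + c`.
cyclic-few : ∀ {k q} c → 1 ≤ k → c * (k + 1) < q → FewForbidden k q (suc c) (suc c) c
cyclic-few {k} {q} c 1≤k small {j} j<q with ≤-<-connex c j
... | inj₂ j<c rewrite flip-< {q} j<c | m≤n⇒m∸n≡0 {j + suc c} {q} (ends-disjoint {k} 1≤k small j<c) | *-zeroʳ k | +-identityʳ (k * (c ∸ j)) =
  few-suffix {k} {q} {suc c} 1≤k (≤-trans (s≤s (*-monoʳ-≤ c (m≤m+n k 1))) small) j<q
... | inj₁ c≤j rewrite m≤n⇒m∸n≡0 (flip-≥c c≤j j<q) | *-zeroʳ k with flip q c j + suc c ≤? q
...   | yes fits rewrite m≤n⇒m∸n≡0 fits | *-zeroʳ k = j<q
...   | no spills with m≤n⇒∃[o]m+o≡n (<⇒≤ (≰⇒> spills)) | m≤n⇒∃[o]m+o≡n c≤j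
...     | d , q+d≡ | e , refl = begin-strict
  k * (flip q c j + suc c ∸ q) + (c + e)  ≡⟨ cong (λ x → k * (x ∸ q) + (c + e)) q+d≡ ⟨
  k * (q + d ∸ q) + (c + e)               ≡⟨ cong (λ x → k * x + (c + e)) (m+n∸m≡n q d) ⟩
  k * d + (c + e)
    ≤⟨ +-monoʳ-≤ (k * d) (+-monoʳ-≤ c (m≤n*m e k {{>-nonZero 1≤k}})) ⟩
  k * d + (c + k * e)
    ≡⟨ solve 4 (λ k c d e → k :* d :+ (c :+ k :* e) := k :* (d :+ e) :+ c) refl k c d e ⟩
  k * (d + e) + c                         ≡⟨ cong (λ x → k * x + c) d+e≡c ⟩
  k * c + c
    ≡⟨ solve 2 (λ k c → k :* c :+ c := c :* (k :+ con 1)) refl k c ⟩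
  c * (k + 1)                             <⟨ small ⟩
  q                                       ∎
  where
  open ≤-Reasoning
  open +-*-Solver
  d+e≡c : d + e ≡ c
  d+e≡c = +-cancelˡ-≡ (q + c) _ _ (begin-equality
    q + c + (d + e)
      ≡⟨ solve 4 (λ q c d e → q :+ c :+ (d :+ e) := q :+ d :+ (c :+ e)) refl q c d e ⟩
    q + d + (c + e)                 ≡⟨ cong (_+ (c + e)) q+d≡ ⟩
    flip q c (c + e) + suc c + (c + e)
      ≡⟨ solve 3 (λ f c x → f :+ (con 1 :+ c) :+ x := f :+ (con 1 :+ x) :+ c) refl (flip q c (c + e)) c (c + e) ⟩
    flip q c (c + e) + suc (c + e) + c ≡⟨ cong (_+ c) (flip-≥ c≤j j<q) ⟩
    q + c + c                       ∎)

[m∸1]*n<o⇒m≤o : ∀ {a k q} → 1 ≤ k → (a ∸ 1) * k < q → a ≤ q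
[m∸1]*n<o⇒m≤o {zero}  _   _     = z≤n
[m∸1]*n<o⇒m≤o {suc a} {k} 1≤k small = ≤-trans (s≤s (m≤m*n a k {{>-nonZero 1≤k}})) small

-- The linear and cyclic bounds.

module Bounds {n k M q} .{{_ : NonZero M}} .{{_ : NonZero q}} (F : Factorisation n k M q)
  (count : M * q ≡ n C k) (1≤k : 1 ≤ k) (r′ : ℕ) (r<M : suc r′ < M) where
  open Concatenate F count
  open Factorisation F

  r = suc r′

  fits : ∀ {L} → L ≤ q → r′ * q + L ≤ n C k
  fits {L} L≤q = begin
    r′ * q + L  ≤⟨ +-monoʳ-≤ (r′ * q) L≤q ⟩
    r′ * q + q  ≡⟨ +-comm (r′ * q) q ⟩
    r * q       ≤⟨ *-monoˡ-≤ q (<⇒≤ r<M) ⟩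
    M * q       ≡⟨ count ⟩
    n C k       ∎
    where open ≤-Reasoning

  linear : ∀ a → (a ∸ 1) * k < q → msAtLeast n k r (r′ * q + a)
  linear a small = ordering ρ ρ-inj , r′ * q + a , ≤-refl , fits a≤q , λ i i+s≤N →
    regular ρ ρ-inj r′ a a≤q i (λ β inside → compatible β
      (*-cancelʳ-< _ _ _ (≤-trans inside (≤-trans i+s≤N (≤-reflexive (sym count))))))
    where
    a≤q = [m∸1]*n<o⇒m≤o 1≤k small
    open Arrange E (λ i → edge-disj (i mod M)) (λ i t → ≤-reflexive (edge-size (i mod M) t))
      -- With `id` and `b = 0` for the later matching, only the matching `r` places before
      -- constrains the order.
      (_∸ r) id a 0 q (linear-few {a = a} 1≤k small)
    open Arranged (arrange M)
    compatible : ∀ β → β + r < M → Compatible a (G ρ ρ-inj β) (G ρ ρ-inj (β + r))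
    compatible β β+r<M
      rewrite m<n⇒m%n≡m β+r<M | m<n⇒m%n≡m (≤-trans (s≤s (m≤m+n β r)) β+r<M) =
      subst (λ i → Compatible a (E i ∘ ρ i) (E (β + r) ∘ ρ (β + r))) (m+n∸n≡m β r)
        (back (β + r) β+r<M (≤-trans (s≤s (≤-reflexive (m+n∸n≡m β r))) (m<m+n β z<s)))

  cyclic : ∀ c → c * (k + 1) < q → cmsAtLeast n k r (r′ * q + suc c)
  cyclic c small = ordering ρ ρ-inj , r′ * q + suc c , ≤-refl , fits b≤q , λ i →
    regular ρ ρ-inj r′ (suc c) b≤q i (λ β _ → compatible β)
    where
    b≤q = [m∸1]*n<o⇒m≤o {suc c} {k + 1} (m≤n+m 1 k) small
    open Arrange E (λ i → edge-disj (i mod M)) (λ i t → ≤-reflexive (edge-size (i mod M) t))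
      (_∸ r) (λ i → (i + r) % M) (suc c) (suc c) c (cyclic-few c 1≤k small)
    open Arranged (arrange M)
    -- Without wrapping, `i + r` was placed after `i`, and `back` applies to it. With wrapping,
    -- `r < M` makes the residue smaller than `i`, and `forth` applies to `i`.
    step : ∀ i → i < M → Compatible (suc c) (E i ∘ ρ i) (E ((i + r) % M) ∘ ρ ((i + r) % M))
    step i i<M with i + r <? M
    ... | yes i+r<M rewrite m<n⇒m%n≡m i+r<M =
      subst (λ x → Compatible (suc c) (E x ∘ ρ x) (E (i + r) ∘ ρ (i + r))) (m+n∸n≡m i r)
        (back (i + r) i+r<M (≤-trans (s≤s (≤-reflexive (m+n∸n≡m i r))) (m<m+n i z<s)))
    ... | no i+r≮M = forth i i<M wraps
      where
      open ≤-Reasoning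
      wraps : (i + r) % M < i
      wraps = begin-strict
        (i + r) % M       ≡⟨ m≤n⇒[n∸m]%m≡n%m (≮⇒≥ i+r≮M) ⟨
        (i + r ∸ M) % M   ≤⟨ m%n≤m (i + r ∸ M) M ⟩
        i + r ∸ M
          <⟨ +-cancelʳ-< M _ _ (subst (_< i + M) (sym (m∸n+n≡m (≮⇒≥ i+r≮M))) (+-monoʳ-< i r<M)) ⟩
        i                 ∎
    compatible : ∀ β → Compatible (suc c) (G ρ ρ-inj β) (G ρ ρ-inj (β + r))
    compatible β = subst (λ x → Compatible (suc c) (G ρ ρ-inj β) (E x ∘ ρ x)) residue
      (step (β % M) (m%n<n β M))
      where
      residue : (β % M + r) % M ≡ (β + r) % M
      residue = trans (%-distribˡ-+ (β % M) r M)
        (trans (cong (λ x → (x + r % M) % M) (m%n%n≡m%n β M)) (sym (%-distribˡ-+ β r M)))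

theorem35 : (k n q a b r : ℕ) → 2 ≤ k → 1 ≤ n → n ≡ q * k
    → (a ∸ 1) * k < q → q ≤ a * k
    → (b ∸ 1) * (k + 1) < q → q ≤ b * (k + 1)
    → 1 ≤ r → r < ΔK n k
    → msAtLeast n k r ((r ∸ 1) * q + a) × cmsAtLeast n k r ((r ∸ 1) * q + b)
-- `b = 0` would give `q ≤ 0` against `0 < q`. Hence `b = suc c`, and `c` is also the number of
-- initial positions filled first.
theorem35 k n q a zero r _ _ _ small _ _ q≤0 _ _ = contradiction (≤-trans small q≤0) λ ()
theorem35 k n q a (suc c) (suc r′) 2≤k 1≤n n≡qk a-small _ c-small _ _ r<M =
  linear a a-small , cyclic c c-small
  where
  1≤k = ≤-trans (s≤s z≤n) 2≤k
  instance
    M≢0 : NonZero (ΔK n k)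
    M≢0 = >-nonZero (≤-trans (s≤s z≤n) r<M)
    q≢0 : NonZero q
    q≢0 = >-nonZero (≤-trans (s≤s z≤n) c-small)
  open Bounds (baranyai k 1≤k 1≤n n≡qk) (edges-count {n} {q} k 1≤k 1≤n n≡qk) 1≤k r′ r<M
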